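{- Let $G$ be a connected graph and let $W\subseteq V(G)$ be a set of pairwise true twins in $G$ with $|W|\geq 2$. Let $S=E(G[W])$ be the set of edges of $G$ with both endpoints in $W$, and $G-S$ the graph obtained from $G$ by deleting these edges. Then \[\operatorname{diam}(\mathcal{R}(G))-\binom{|W|}{2}\leq \operatorname{diam}(\mathcal{R}(G-S)).\]
   Context: Two vertices $u,v$ are true twins if $N[u]=N[v]$ (closed neighbourhoods). For a connected graph $G$, a search tree on $G$ is a rooted tree with vertex set $V(G)$ defined recursively: its root is some vertex $r\in V(G)$, and the children of $r$ are the roots of search trees on the connected components of $G-r$. For a rooted tree $T$ and $w\in V(T)$, $T|w$ denotes the subtree rooted at $w$. Let $T$ be a search tree on $G$, let $v$ be a child of $u$ in $T$, and let $p$ be the parent of $u$ (if it exists). The $uv$-rotation transforms $T$ into the search tree $T'$ in which: $u$ is a child of $v$ and $v$ is a child of $p$ (or $v$ is the root if $u$ was the root); every subtree of $u$ in $T$ other than $T|v$ is a subtree of $u$ in $T'$; and every subtree $S$ of $v$ in $T$ is a subtree of $u$ in $T'$ if $u$ is adjacent in $G$ to some vertex of $S$, and a subtree of $v$ in $T'$ otherwise. The rotation graph $\mathcal{R}(G)$ is the graph whose vertices are the search trees on $G$, two being adjacent iff they differ by one rotation. $\operatorname{diam}$ denotes graph diameter. -}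

module Defs where

open import Data.Fin.Base using (Fin)
open import Data.Fin.Subset using (Subset; _∈_; _-_; ⊤)
open import Data.Fin.Subset.Properties using (_∈?_)
open import Data.Maybe.Base using (Maybe; just; nothing)
open import Data.Nat.Base using (ℕ; zero; suc; _≤_)
open import Data.Product.Base using (∃; ∃₂; _×_; _,_; map)
open import Data.Sum.Base using (_⊎_)
open import Function.Base using (_∘_)
open import Function.Bundles using (_⇔_)
open import Level using (0ℓ)
open import Relation.Binary.Bundles using (Setoid)
open import Relation.Binary.Core using (Rel)
open import Relation.Binary.Definitions using (Symmetric; Irreflexive; Decidable)
open import Relation.Binary.Construct.Closure.ReflexiveTransitive using (Star)
open import Relation.Binary.Construct.Closure.Symmetric using (SymClosure)
import Relation.Binary.Construct.On as On
open import Relation.Binary.PropositionalEquality using (_≡_; _≢_; _→-setoid_)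
open import Relation.Nullary using (¬_)
open import Relation.Nullary.Decidable using (_×-dec_; ¬?)
open import Relation.Unary using (Pred; _≐_)

------------------------------------------------------------------------
-- Finite simple graphs

record Graph (n : ℕ) : Set₁ where
  field
    Adj    : Rel (Fin n) 0ℓ
    sym    : Symmetric Adj
    irrefl : Irreflexive _≡_ Adj
    adj?   : Decidable Adj

module _ {n : ℕ} where
  open Graph

  Connected : Graph n → Set
  Connected G = ∀ u v → Star (Adj G) u v

  N[_,_] : Graph n → Fin n → Pred (Fin n) 0ℓ
  N[ G , u ] x = x ≡ u ⊎ Adj G u x

  TrueTwins : Graph n → Rel (Fin n) 0ℓ
  TrueTwins G u v = N[ G , u ] ≐ N[ G , v ]

  PairwiseTrueTwins : Graph n → Subset n → Set
  PairwiseTrueTwins G W = ∀ {u v} → u ∈ W → v ∈ W → TrueTwins G u v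

  -- E(G[W]), a set of edges being the same thing as a graph on all of Fin n.
  E[_,_] : Graph n → Subset n → Graph n
  E[ G , W ] = record
    { Adj    = λ x y → Adj G x y × x ∈ W × y ∈ W
    ; sym    = λ (xy , x∈W , y∈W) → sym G xy , y∈W , x∈W
    ; irrefl = λ x≡y (xy , _) → irrefl G x≡y xy
    ; adj?   = λ x y → adj? G x y ×-dec (x ∈? W) ×-dec (y ∈? W)
    }

  _−ᴱ_ : Graph n → Graph n → Graph n
  G −ᴱ S = record
    { Adj    = λ x y → Adj G x y × ¬ Adj S x y
    ; sym    = map (sym G) (_∘ sym S)
    ; irrefl = λ x≡y (xy , _) → irrefl G x≡y xy
    ; adj?   = λ x y → adj? G x y ×-dec ¬? (adj? S x y)
    }

  -- There is a path from x to y in the induced subgraph G[U] (for x ∈ U).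
  Reach : Graph n → Subset n → Rel (Fin n) 0ℓ
  Reach G U = Star (λ a b → a ∈ U × b ∈ U × Adj G a b)

  -- C is the vertex set of a connected component of G[U].
  IsComponent : Graph n → Subset n → Subset n → Set
  IsComponent G U C = ∃ λ x → x ∈ U × (∀ y → y ∈ C ⇔ Reach G U x y)

------------------------------------------------------------------------
-- Search trees

  -- Rooted trees and forests on Fin n are encoded by their parent map, which
  -- is `nothing` exactly at the roots.
  Parents : Set
  Parents = Fin n → Maybe (Fin n)

  -- SearchTreeOn G π U r: π restricts to a search tree on the connected
  -- graph G[U] with root r.
  -- SearchForestOn G π U q: π restricts to one search tree on each connected
  -- component of G[U], and the root of each of them has parent q.
  data SearchTreeOn (G : Graph n) (π : Parents) : Subset n → Fin n → Set
  SearchForestOn : Graph n → Parents → Subset n → Maybe (Fin n) → Set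

  data SearchTreeOn G π where
    node : ∀ {U r} → r ∈ U → SearchForestOn G π (U - r) (just r) →
           SearchTreeOn G π U r

  SearchForestOn G π U q =
    ∀ C → IsComponent G U C → ∃ λ r → π r ≡ q × SearchTreeOn G π C r

  -- For connected G this is a single search tree on G.  A graph with several
  -- components gets one search tree per component.
  record SearchTree (G : Graph n) : Set where
    field
      parent   : Parents
      isSearch : SearchForestOn G parent ⊤ nothing

  open SearchTree

  -- x is a vertex of T|w.
  InSubtree : {G : Graph n} → SearchTree G → Fin n → Fin n → Set
  InSubtree T w x = Star (λ a b → parent T a ≡ just b) x w

  AdjacentToSubtree : {G : Graph n} → SearchTree G → Fin n → Fin n → Set
  AdjacentToSubtree {G} T u w = ∃ λ x → InSubtree T w x × Adj G u x

  -- T′ is the result of the uv-rotation of T.  Subtrees hanging off u or v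
  -- are moved as a whole, so only the parents of u, v and the children of v
  -- can change; `rest` includes the children of u other than v.
  record IsRotation {G : Graph n} (u v : Fin n) (T T′ : SearchTree G) : Set where
    field
      child : parent T v ≡ just u
      upper : parent T′ v ≡ parent T u
      lower : parent T′ u ≡ just v
      move  : ∀ s → parent T s ≡ just v → AdjacentToSubtree T u s →
              parent T′ s ≡ just u
      stay  : ∀ s → parent T s ≡ just v → ¬ AdjacentToSubtree T u s →
              parent T′ s ≡ just v
      rest  : ∀ x → x ≢ u → x ≢ v → parent T x ≢ just v →
              parent T′ x ≡ parent T x

------------------------------------------------------------------------
-- Rotation graphs and diameters

-- Vertices form a setoid because search trees are to be compared by their
-- parent maps only.
record SetoidGraph : Set₁ where
  field
    vertices : Setoid 0ℓ 0ℓ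
  open Setoid vertices public renaming (Carrier to Vertex)
  field
    Edge : Rel Vertex 0ℓ

𝓡 : ∀ {n} → Graph n → SetoidGraph
𝓡 {n} G = record
  { vertices = On.setoid (Fin n →-setoid Maybe (Fin n)) (SearchTree.parent {G = G})
  ; Edge     = SymClosure (λ T T′ → ∃₂ λ u v → IsRotation u v T T′)
  }

module _ (H : SetoidGraph) where
  open SetoidGraph H

  data Walk : ℕ → Rel Vertex 0ℓ where
    nil  : ∀ {x y} → x ≈ y → Walk zero x y
    cons : ∀ {k x y z} → Edge x y → Walk k y z → Walk (suc k) x z

  IsDistance : Vertex → Vertex → ℕ → Set
  IsDistance x y d = Walk d x y × (∀ k → Walk k x y → d ≤ k)

  -- d is the maximum of the distances; in particular H is connected.
  IsDiameter : ℕ → Set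
  IsDiameter d = (∀ x y → ∃ λ k → IsDistance x y k × k ≤ d)
               × (∃₂ λ x y → IsDistance x y d)

{-# OPTIONS --safe #-}
module Submission where

-- A search tree is the elimination tree of any of its linear extensions, and
-- exchanging two consecutive vertices of an elimination order rotates the tree
-- if they are joined in the graph induced on what has not been eliminated, and
-- keeps the tree otherwise.  Thus walks in 𝓡(G) are sequences of such exchanges,
-- a free one being one that keeps the tree.
-- Let H = G − E(G[W]), and let σ and τ be orders of two search trees on G.  A
-- shortest walk between the trees of σ and τ on H is a sequence of exchanges
-- from σ to τ, of cost at most diam 𝓡(H).  It is carried out on G forgetting the
-- labels in W: an exchange not inside W is copied, and costs the same because W
-- consists of twins.  An exchange inside W is performed only if it puts the two
-- labels in the order they have in τ; this removes an inversion, so it happens at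
-- most |W|(|W|−1)/2 times.  As in a sorting network, the labels then are at least
-- as sorted as those of the original sequence, so the result is τ again.

open import Defs
open import Data.Bool.Base using (true; false; if_then_else_)
open import Data.Fin.Base using (Fin)
open import Data.Fin.Properties using (_≟_)
open import Data.Fin.Subset using (Subset; ∣_∣; ⊤; _─_)
  renaming (_∈_ to _∈ˢ_; _∉_ to _∉ˢ_; _-_ to _-ˢ_)
open import Data.Fin.Subset.Properties using (∈⊤; p─q⊆p; x∈p∧x≢y⇒x∈p-y; x∈⁅x⁆)
  renaming (_∈?_ to _∈ˢ?_)
open import Data.Integer.Base using (+_; _-_) renaming (_≤_ to _≤ℤ_)
import Data.Integer.Base as ℤ using (_⊖_)
import Data.Integer.Properties as ℤ
open import Data.List.Base as List using (List; []; _∷_; _++_; allFin; map; length)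
import Data.List.Membership.DecPropositional as DecMembership
open import Data.List.Membership.Propositional using (_∈_; _∉_)
open import Data.List.Membership.Propositional.Properties
  using (∈-allFin; ∈-∃++; ∈-insert; ∈-++⁺ʳ)
open import Data.List.Properties using (map-tabulate)
open import Data.List.Relation.Binary.Permutation.Propositional as ↭
  using (_↭_; ↭-refl; ↭-sym; ↭-trans; ↭⇒↭ₛ)
open import Data.List.Relation.Binary.Permutation.Propositional.Properties
  using (∈-resp-↭; All-resp-↭; shift; drop-∷; ++⁺ˡ; ↭-empty-inv; map⁺; ↭-length)
import Data.List.Relation.Binary.Permutation.Setoid.Properties as Permutationₛ
open import Data.List.Relation.Unary.All as All using (All; []; _∷_)
open import Data.List.Relation.Unary.All.Properties using (++⁻ˡ)
open import Data.List.Relation.Unary.AllPairs as AllPairs using (AllPairs; []; _∷_)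
open import Data.List.Relation.Unary.Any using (here; there)
open import Data.List.Relation.Unary.Sorted.TotalOrder.Properties using (Sorted⇒AllPairs)
open import Data.List.Relation.Unary.Unique.Propositional using (Unique)
open import Data.List.Relation.Unary.Unique.Propositional.Properties using (allFin⁺)
import Data.List.Sort as Sort
open import Data.Maybe.Base using (Maybe; just; nothing; _<∣>_)
open import Data.Maybe.Properties using (just-injective)
open import Data.Nat.Base using (ℕ; zero; suc; _+_; _∸_; _≤_; _<_; s≤s; z≤n)
open import Data.Nat.Combinatorics using (_C_; nC1≡n; nCk+nC[k+1]≡[n+1]C[k+1])
open import Data.Nat.ListAction using (sum)
open import Data.Nat.ListAction.Properties using (sum-↭)
open import Data.Nat.Properties
  using ( _≤?_; _<?_; ≤-refl; ≤-reflexive; ≤-trans; <-irrefl; <-asym; <-≤-trans; <⇒≤; ≮⇒≥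
        ; ≤-decTotalOrder; 1+n≢n; 1+n≰n; suc-injective; m≤m+n; m≤n+m; m+n∸n≡m
        ; +-assoc; +-mono-≤; +-monoˡ-≤; +-monoʳ-≤; +-cancelˡ-≤; +-commutativeSemigroup
        ; module ≤-Reasoning )
open import Algebra.Properties.CommutativeSemigroup +-commutativeSemigroup using (x∙yz≈y∙xz)
open import Data.Nat.Solver using (module +-*-Solver)
open import Data.Product.Base using (∃; ∃₂; _×_; _,_; proj₁; proj₂)
open import Data.Sum.Base using (_⊎_; inj₁; inj₂)
open import Data.Vec.Base as Vec using (tabulate; _∷_; here; there)
open import Data.Vec.Properties using (lookup∘tabulate; []=⇒lookup; lookup⇒[]=)
open import Function.Base using (_∘_; id)
open import Function.Bundles using (mk⇔; module Equivalence)
open import Level using (0ℓ)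
open import Relation.Binary.Bundles using (DecTotalOrder)
open import Relation.Binary.Construct.Closure.ReflexiveTransitive as Star
  using (Star; ε; _◅_; _◅◅_)
open import Relation.Binary.Construct.Closure.Symmetric using (fwd; bwd)
import Relation.Binary.Construct.On as On
open import Relation.Binary.Core using (Rel)
open import Relation.Binary.Definitions using (Decidable)
open import Relation.Binary.PropositionalEquality
  using (_≡_; _≢_; _≗_; refl; sym; trans; cong; cong₂; subst; subst₂; setoid)
open import Relation.Nullary using (¬_; Dec; yes; no; contradiction)
open import Relation.Nullary.Decidable using (_×-dec_; _⊎-dec_; map′; does; dec-true)
open import Relation.Unary as U using (Pred)
open +-*-Solver using (solve; _:+_; _:=_)

private variable n : ℕ

module _ {n : ℕ} where
  open DecMembership (_≟_ {n}) public using (_∈?_)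

-- Finite relations and subsets

-- Floyd–Warshall: walks whose intermediate points all lie in the list.
Via : Rel (Fin n) 0ℓ → List (Fin n) → Rel (Fin n) 0ℓ
Via E []      x y = x ≡ y ⊎ E x y
Via E (v ∷ l) x y = Via E l x y ⊎ (Via E l x v × Via E l v y)

module _ {E : Rel (Fin n) 0ℓ} where

  via? : Decidable E → ∀ l → Decidable (Via E l)
  via? E? []      x y = (x ≟ y) ⊎-dec E? x y
  via? E? (v ∷ l) x y = via? E? l x y ⊎-dec (via? E? l x v ×-dec via? E? l v y)

  via-base : ∀ l {x y} → x ≡ y ⊎ E x y → Via E l x y
  via-base []      p = p
  via-base (_ ∷ l) p = inj₁ (via-base l p)

  -- Composition is possible only at points of the list. If both halves pass through the head `v`,
  -- the closed walk between the two visits is dropped, so `v` is still used once.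
  via-trans : ∀ {l x y z} → y ∈ l → Via E l x y → Via E l y z → Via E l x z
  via-trans {v ∷ l} (here refl) p q = inj₂ (front p , back q)
    where
    front : ∀ {x} → Via E (v ∷ l) x v → Via E l x v
    front (inj₁ p)       = p
    front (inj₂ (p , _)) = p
    back : ∀ {z} → Via E (v ∷ l) v z → Via E l v z
    back (inj₁ q)       = q
    back (inj₂ (_ , q)) = q
  via-trans (there y∈l) (inj₁ p)       (inj₁ q)       = inj₁ (via-trans y∈l p q)
  via-trans (there y∈l) (inj₁ p)       (inj₂ (q , r)) = inj₂ (via-trans y∈l p q , r)
  via-trans (there y∈l) (inj₂ (p , q)) (inj₁ r)       = inj₂ (p , via-trans y∈l q r)
  via-trans (there y∈l) (inj₂ (p , _)) (inj₂ (_ , q)) = inj₂ (p , q)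

  via⇒star : ∀ l {x y} → Via E l x y → Star E x y
  via⇒star []      (inj₁ refl)    = ε
  via⇒star []      (inj₂ e)       = e ◅ ε
  via⇒star (_ ∷ l) (inj₁ p)       = via⇒star l p
  via⇒star (_ ∷ l) (inj₂ (p , q)) = via⇒star l p ◅◅ via⇒star l q

  star⇒via : ∀ {x y} → Star E x y → Via E (allFin n) x y
  star⇒via ε       = via-base (allFin n) (inj₁ refl)
  star⇒via (e ◅ p) = via-trans (∈-allFin _) (via-base (allFin n) (inj₂ e)) (star⇒via p)

  star? : Decidable E → Decidable (Star E)
  star? E? x y = map′ (via⇒star (allFin n)) star⇒via (via? E? (allFin n) x y)

module _ {P : Pred (Fin n) 0ℓ} (P? : U.Decidable P) where

  ⟦_⟧ : Subset n
  ⟦_⟧ = tabulate (λ x → does (P? x))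

  ∈⟦⟧⁺ : ∀ {x} → P x → x ∈ˢ ⟦_⟧
  ∈⟦⟧⁺ {x} px = lookup⇒[]= x _ (trans (lookup∘tabulate _ x) (dec-true (P? x) px))

  ∈⟦⟧⁻ : ∀ {x} → x ∈ˢ ⟦_⟧ → P x
  ∈⟦⟧⁻ {x} x∈ with P? x | trans (sym (lookup∘tabulate (λ x → does (P? x)) x)) ([]=⇒lookup x∈)
  ... | yes px | _ = px
  ... | no _   | ()

x∈p─q⇒x∉q : ∀ {p q : Subset n} {x} → x ∈ˢ p ─ q → x ∉ˢ q
x∈p─q⇒x∉q {p = _     ∷ _} {q = _    ∷ _} (there x∈) (there x∈q) = x∈p─q⇒x∉q x∈ x∈q
x∈p─q⇒x∉q {p = true  ∷ _} {q = true ∷ _} () here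
x∈p─q⇒x∉q {p = false ∷ _} {q = true ∷ _} () here

x∉p-x : ∀ {p : Subset n} {x} → x ∉ˢ p -ˢ x
x∉p-x {p = p} x∈ = x∈p─q⇒x∉q {p = p} x∈ (x∈⁅x⁆ _)

-- For membership in a subset `U` this is `Reach K U` by definition; predicates allow for lists and
-- for the vertices below a given one as well.
Path : Graph n → Pred (Fin n) 0ℓ → Rel (Fin n) 0ℓ
Path K P = Star (λ x y → P x × P y × Graph.Adj K x y)

-- Elimination orders

Order : List (Fin n) → Set
Order l = l ↭ allFin _

order-∈ : ∀ {l : List (Fin n)} → Order l → ∀ x → x ∈ l
order-∈ ord x = ∈-resp-↭ (↭-sym ord) (∈-allFin x)

order-unique : ∀ {l : List (Fin n)} → Order l → Unique l
order-unique ord = Permutationₛ.Unique-resp-↭ (setoid _) (↭⇒↭ₛ (↭-sym ord)) (allFin⁺ _)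

onlyIf : {A B : Set} → Dec A → B → Maybe B
onlyIf (yes _) b = just b
onlyIf (no _)  b = nothing

module SearchTrees {n : ℕ} (K : Graph n) where
  open Graph K using (Adj; adj?)
  open SearchTree using (parent)

  -- Paths and components

  path? : ∀ {P} → U.Decidable P → Decidable (Path K P)
  path? P? = star? (λ x y → P? x ×-dec P? y ×-dec adj? x y)

  path-sym : ∀ {P x y} → Path K P x y → Path K P y x
  path-sym = Star.reverse (λ (px , py , xy) → py , px , Graph.sym K xy)

  path-mono : ∀ {P Q} → P U.⊆ Q → ∀ {x y} → Path K P x y → Path K Q x y
  path-mono P⊆Q = Star.map (λ (px , py , xy) → P⊆Q px , P⊆Q py , xy)

  path-end : ∀ {P x y} → P x → Path K P x y → P y
  path-end px ε                  = px
  path-end px ((_ , py , _) ◅ p) = path-end py p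

  path-confine : ∀ {P Q} → (∀ {x y} → Q x → P x → P y → Adj x y → Q y) →
                 ∀ {x y} → Q x → Path K P x y → Path K (P U.∩ Q) x y
  path-confine closed qx ε                    = ε
  path-confine closed qx ((px , py , xy) ◅ p) =
    ((px , qx) , (py , qy) , xy) ◅ path-confine closed qy p
    where qy = closed qx px py xy

  -- Every vertex of the path is reachable from `x`, and `b` is not.
  path-avoid : ∀ {b l x y} → ¬ Path K (_∈ b ∷ l) x b →
               Path K (_∈ b ∷ l) x y → Path K (_∈ l) x y
  path-avoid {b} {l} {x} ¬xb p =
    path-mono strip (path-confine {Q = Path K (_∈ b ∷ l) x}
                       (λ xz z∈ w∈ zw → xz ◅◅ (z∈ , w∈ , zw) ◅ ε) ε p)
    where
    strip : ∀ {z} → z ∈ b ∷ l × Path K (_∈ b ∷ l) x z → z ∈ l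
    strip (here refl , xb) = contradiction xb ¬xb
    strip (there z∈ , _)   = z∈

  -- The path is cut at its first arrival in `a`, and `z` is the vertex before that.
  path-last : ∀ {a l x} → x ∈ l → a ∉ l → Path K (_∈ a ∷ l) x a →
              ∃ λ z → z ∈ l × Path K (_∈ l) x z × Adj z a
  path-last x∈ a∉ ε = contradiction x∈ a∉
  path-last x∈ a∉ ((_ , here refl , xa) ◅ _) = _ , x∈ , ε , xa
  path-last x∈ a∉ ((_ , there y∈ , xy) ◅ p) with path-last y∈ a∉ p
  ... | z , z∈ , yz , za = z , z∈ , (x∈ , y∈ , xy) ◅ yz , za

  module _ {U D : Subset n} (comp : IsComponent K U D) where
    private
      x₀   = proj₁ comp
      x₀∈U = proj₁ (proj₂ comp)
      to : ∀ {y} → y ∈ˢ D → Reach K U x₀ y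
      to = Equivalence.to (proj₂ (proj₂ comp) _)
      from : ∀ {y} → Reach K U x₀ y → y ∈ˢ D
      from = Equivalence.from (proj₂ (proj₂ comp) _)

    comp-root : ∃ λ x → x ∈ˢ D
    comp-root = x₀ , from ε

    comp-⊆ : ∀ {x} → x ∈ˢ D → x ∈ˢ U
    comp-⊆ x∈ = path-end x₀∈U (to x∈)

    comp-path : ∀ {x y} → x ∈ˢ D → Reach K U x y → y ∈ˢ D
    comp-path x∈ p = from (to x∈ ◅◅ p)

    comp-confine : ∀ {x y} → x ∈ˢ D → Reach K U x y → Reach K D x y
    comp-confine x∈ p = path-mono proj₂
      (path-confine (λ x∈ x∈U y∈U xy → comp-path x∈ ((x∈U , y∈U , xy) ◅ ε)) x∈ p)

    comp-connected : ∀ {x y} → x ∈ˢ D → y ∈ˢ D → Reach K D x y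
    comp-connected x∈ y∈ = comp-confine x∈ (path-sym (to x∈) ◅◅ to y∈)

  -- Subsets are Boolean vectors, so the component is obtained by deciding reachability.
  component : ∀ {U x} → x ∈ˢ U → ∃ λ D → IsComponent K U D × x ∈ˢ D
  component {U} {x} x∈ = ⟦ x? ⟧ , (x , x∈ , λ y → mk⇔ (∈⟦⟧⁻ x?) (∈⟦⟧⁺ x?)) , ∈⟦⟧⁺ x? ε
    where x? = path? (_∈ˢ? U) x

  mkComponent : ∀ {U D x} → x ∈ˢ U → x ∈ˢ D → (∀ {y} → y ∈ˢ D → Reach K U x y) →
                (∀ {y} → Reach K U x y → y ∈ˢ D) → IsComponent K U D
  mkComponent x∈U x∈D f g = _ , x∈U , λ _ → mk⇔ f g

  -- The search tree of an elimination order

  Below : Fin n → List (Fin n) → Pred (Fin n) 0ℓ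
  Below y l x = x ∈ l × Path K (_∈ y ∷ l) x y

  abstract
    below? : ∀ y l → U.Decidable (Below y l)
    below? y l x = (x ∈? l) ×-dec path? (_∈? (y ∷ l)) x y

  -- Orders list roots first.  The parent of x in the tree of K[l] is the last y
  -- before x that is joined to x in the graph induced on y and what follows y.
  par : List (Fin n) → Parents
  par []      x = nothing
  par (y ∷ l) x = par l x <∣> onlyIf (below? y l x) y

  par-there : ∀ {y l x q} → par l x ≡ just q → par (y ∷ l) x ≡ just q
  par-there eq rewrite eq = refl

  par-here : ∀ {y l x} → par l x ≡ nothing → Below y l x → par (y ∷ l) x ≡ just y
  par-here {y} {l} {x} eq b rewrite eq with below? y l x
  ... | yes _ = refl
  ... | no ¬b = contradiction b ¬b

  par-none : ∀ {y l x} → par l x ≡ nothing → ¬ Below y l x → par (y ∷ l) x ≡ nothing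
  par-none {y} {l} {x} eq ¬b rewrite eq with below? y l x
  ... | yes b = contradiction b ¬b
  ... | no _  = refl

  par-inv : ∀ {y l x q} → par (y ∷ l) x ≡ just q →
            par l x ≡ just q ⊎ (par l x ≡ nothing × q ≡ y × Below y l x)
  par-inv {y} {l} {x} eq with par l x
  ... | just _  = inj₁ eq
  ... | nothing with below? y l x
  par-inv refl | nothing | yes b = inj₂ (refl , refl , b)
  par-inv ()   | nothing | no _

  par-∈ : ∀ {l x q} → par l x ≡ just q → x ∈ l × q ∈ l
  par-∈ {_ ∷ l} eq with par-inv {l = l} eq
  ... | inj₁ eq′               = let x∈ , q∈ = par-∈ {l} eq′ in there x∈ , there q∈
  ... | inj₂ (_ , refl , x∈ , _) = there x∈ , here refl

  par-∉ : ∀ {l x} → x ∉ l → par l x ≡ nothing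
  par-∉ {l} {x} x∉ with par l x in eq
  ... | nothing = refl
  ... | just _  = contradiction (proj₁ (par-∈ {l} eq)) x∉

  par-first : ∀ {y l} → y ∉ l → par (y ∷ l) y ≡ nothing
  par-first y∉ = par-none (par-∉ y∉) (y∉ ∘ proj₁)

  component-avoiding : ∀ {U D y} → IsComponent K U D → y ∉ˢ D → IsComponent K (U -ˢ y) D
  component-avoiding {U} {D} {y} comp y∉ with comp-root comp
  ... | x , x∈ = mkComponent (avoid x∈) x∈
      (λ z∈ → path-mono avoid (comp-connected comp x∈ z∈))
      (λ p → comp-path comp x∈ (path-mono (p─q⊆p U _) p))
    where
    avoid : ∀ {z} → z ∈ˢ D → z ∈ˢ U -ˢ y
    avoid z∈ = x∈p∧x≢y⇒x∈p-y (comp-⊆ comp z∈) λ { refl → y∉ z∈ }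

  -- A path in `U -ˢ y` that starts in `D` stays in `D`, because `D` is a component of `U`. So
  -- putting back the rest of `U` does not enlarge `D′`.
  component-below : ∀ {U D D′ y} → IsComponent K U D → IsComponent K (D -ˢ y) D′ →
                    IsComponent K (U -ˢ y) D′
  component-below {U} {D} {D′} {y} comp comp′ with comp-root comp′
  ... | x , x∈ = mkComponent (lift (comp-⊆ comp′ x∈)) x∈
      (λ z∈ → path-mono (lift ∘ comp-⊆ comp′) (comp-connected comp′ x∈ z∈))
      (λ p → comp-path comp′ x∈ (path-mono lower
               (path-confine (λ x∈D x∈U y∈U xy → comp-path comp x∈D
                                ((p─q⊆p U _ x∈U , p─q⊆p U _ y∈U , xy) ◅ ε))
                  (p─q⊆p D _ (comp-⊆ comp′ x∈)) p)))
    where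
    lift : ∀ {z} → z ∈ˢ D -ˢ y → z ∈ˢ U -ˢ y
    lift z∈ = x∈p∧x≢y⇒x∈p-y (comp-⊆ comp (p─q⊆p D _ z∈)) λ { refl → x∉p-x {p = D} z∈ }
    lower : ∀ {z} → z ∈ˢ U -ˢ y × z ∈ˢ D → z ∈ˢ D -ˢ y
    lower (z∈ , z∈D) = x∈p∧x≢y⇒x∈p-y z∈D λ { refl → x∉p-x {p = U} z∈ }

  private
    remove : (U : Subset n) (y : Fin n) → ∀ {l} → (∀ {x} → x ∈ˢ U → x ∈ y ∷ l) →
             ∀ {x} → x ∈ˢ U -ˢ y → x ∈ l
    remove U y U⊆l x∈ with U⊆l (p─q⊆p U _ x∈)
    ... | here refl = contradiction x∈ (x∉p-x {p = U} {x = y})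
    ... | there x∈l = x∈l

    keep : (U : Subset n) (y : Fin n) → ∀ {l} → (∀ {x} → x ∈ y ∷ l → x ∈ˢ U) → All (y ≢_) l →
           ∀ {x} → x ∈ l → x ∈ˢ U -ˢ y
    keep U y l⊆U y≢ x∈ = x∈p∧x≢y⇒x∈p-y (l⊆U (there x∈)) (All.lookup y≢ x∈ ∘ sym)

  -- Here `l` is a suffix of an order and `π` the parent map of the whole. They agree where `par l`
  -- is defined, but roots of `par l` may still get a parent from in front of `l`. The vertex `y`
  -- becomes the root of its own component; any other component survives the removal of `y`.
  par-search : ∀ {π} l → Unique l → (∀ {x p} → par l x ≡ just p → π x ≡ just p) →
               ∀ {U} → (∀ {x} → x ∈ˢ U → x ∈ l) → (∀ {x} → x ∈ l → x ∈ˢ U) →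
               ∀ {D} → IsComponent K U D →
               ∃ λ r → r ∈ˢ D × par l r ≡ nothing × SearchTreeOn K π D r
  par-search [] _ _ U⊆l _ comp with comp-root comp
  ... | _ , x∈D = contradiction (U⊆l (comp-⊆ comp x∈D)) λ ()
  par-search {π} (y ∷ l) (y≢ ∷ uniq) ext {U} U⊆l l⊆U {D} comp with y ∈ˢ? D
  ... | yes y∈D = y , y∈D , par-first (λ y∈ → All.lookup y≢ y∈ refl) , node y∈D subtree
    where
    subtree : SearchForestOn K π (D -ˢ y) (just y)
    subtree D′ comp′
      with r , r∈ , eq , t ← par-search l uniq (ext ∘ par-there) (remove U y U⊆l) (keep U y l⊆U y≢)
                               (component-below comp comp′)
      = r , ext (par-here eq (remove U y U⊆l (comp-⊆ (component-below comp comp′) r∈) ,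
                    path-mono U⊆l (comp-connected′ (p─q⊆p D _ (comp-⊆ comp′ r∈)))))
          , t
      where
      comp-connected′ : ∀ {r} → r ∈ˢ D → Reach K U r y
      comp-connected′ r∈ = path-mono (comp-⊆ comp) (comp-connected comp r∈ y∈D)
  ... | no y∉D
      with r , r∈ , eq , t ← par-search l uniq (ext ∘ par-there) (remove U y U⊆l) (keep U y l⊆U y≢)
                               (component-avoiding comp y∉D)
      = r , r∈ , par-none eq (λ (_ , p) → y∉D (comp-path comp r∈ (path-mono l⊆U p))) , t

  tree : ∀ l → Order l → SearchTree K
  tree l ord = record
    { parent   = par l
    ; isSearch = λ D comp →
        let r , _ , eq , t =
              par-search l (order-unique ord) id (λ _ → order-∈ ord _) (λ _ → ∈⊤) comp
        in r , eq , t
    }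

  -- Search trees as ordered sets

  Chain : Parents {n} → Rel (Fin n) 0ℓ
  Chain π = Star (λ x y → π x ≡ just y)

  chain-linear : ∀ {π x y z} → Chain π x y → Chain π x z → Chain π y z ⊎ Chain π z y
  chain-linear ε q = inj₁ q
  chain-linear p ε = inj₂ p
  chain-linear (e ◅ p) (f ◅ q) with refl ← just-injective (trans (sym e) f) = chain-linear p q

  chain-up : ∀ {π x y} → Chain π x y → x ≢ y → ∃ λ p → π x ≡ just p × Chain π p y
  chain-up ε       x≢x = contradiction refl x≢x
  chain-up (e ◅ p) _   = _ , e , p

  module _ {π : Parents {n}} where

    tree-chain : ∀ {D r x} → SearchTreeOn K π D r → x ∈ˢ D → Chain π x r
    tree-chain {r = r} {x} (node _ f) x∈ with x ≟ r
    ... | yes refl = ε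
    ... | no x≢r with D′ , comp , x∈D′ ← component (x∈p∧x≢y⇒x∈p-y x∈ x≢r) with f D′ comp
    ... | r′ , e , t = tree-chain t x∈D′ ◅◅ e ◅ ε

    tree-comparable : ∀ {D r x y} → SearchTreeOn K π D r → x ∈ˢ D → y ∈ˢ D → Adj x y →
                      Chain π x y ⊎ Chain π y x
    tree-comparable {r = r} {x} {y} t@(node _ f) x∈ y∈ xy with x ≟ r | y ≟ r
    ... | yes refl | _ = inj₂ (tree-chain t y∈)
    ... | _ | yes refl = inj₁ (tree-chain t x∈)
    ... | no x≢r | no y≢r
        with x∈′ ← x∈p∧x≢y⇒x∈p-y x∈ x≢r | y∈′ ← x∈p∧x≢y⇒x∈p-y y∈ y≢r
        with D′ , comp , x∈D′ ← component x∈′ with f D′ comp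
    ... | r′ , e , t′ = tree-comparable t′ x∈D′ (comp-path comp x∈D′ ((x∈′ , y∈′ , xy) ◅ ε)) xy

    -- One level above the subtree with root `x`, the set `D` is connected, contains `x` and its
    -- parent `r`, and lies entirely below `r`.
    tree-joined : ∀ {D r x} → SearchTreeOn K π D r →
                  (∀ {x y} → x ∈ˢ D → y ∈ˢ D → Reach K D x y) → x ∈ˢ D →
                  x ≡ r ⊎ ∃ λ p → π x ≡ just p × Path K (λ z → Chain π z p) x p
    tree-joined {r = r} {x} t@(node r∈ f) conn x∈ with x ≟ r
    ... | yes x≡r = inj₁ x≡r
    ... | no x≢r with D′ , comp , x∈D′ ← component (x∈p∧x≢y⇒x∈p-y x∈ x≢r) with f D′ comp
    ... | r′ , e , t′ with tree-joined t′ (comp-connected comp) x∈D′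
    ... | inj₁ refl = inj₂ (r , e , path-mono (tree-chain t) (conn x∈ r∈))
    ... | inj₂ j    = inj₂ j

  -- `joined` is the connectedness of subtrees, put without reference to components.
  record IsSearchOrder (π : Parents) : Set where
    field
      rooted     : ∀ x → ∃ λ r → Chain π x r × π r ≡ nothing
      comparable : ∀ {x y} → Adj x y → Chain π x y ⊎ Chain π y x
      joined     : ∀ {x p} → π x ≡ just p → Path K (λ z → Chain π z p) x p

    private
      chainLength : ∀ {x r} → Chain π x r → ℕ
      chainLength ε       = 0
      chainLength (_ ◅ p) = suc (chainLength p)

      chainLength-unique : ∀ {x r s} (p : Chain π x r) (q : Chain π x s) →
                           π r ≡ nothing → π s ≡ nothing → chainLength p ≡ chainLength q
      chainLength-unique ε       ε       _  _  = refl
      chainLength-unique ε       (f ◅ q) r↑ _  with () ← trans (sym r↑) f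
      chainLength-unique (e ◅ p) ε       _  s↑ with () ← trans (sym s↑) e
      chainLength-unique (e ◅ p) (f ◅ q) r↑ s↑ with refl ← just-injective (trans (sym e) f) =
        cong suc (chainLength-unique p q r↑ s↑)

    depth : Fin n → ℕ
    depth x = chainLength (proj₁ (proj₂ (rooted x)))

    depth-parent : ∀ {x p} → π x ≡ just p → depth x ≡ suc (depth p)
    depth-parent {x} {p} e with rooted x | rooted p
    ... | r , xr , r↑ | s , ps , s↑ = chainLength-unique xr (e ◅ ps) r↑ s↑

    acyclic : ∀ {x} → π x ≢ just x
    acyclic e = 1+n≢n (sym (depth-parent e))

  isSearchOrder : (T : SearchTree K) → IsSearchOrder (SearchTree.parent T)
  isSearchOrder T = record
    { rooted     = λ x → let D , comp , x∈ = component {U = ⊤} {x} ∈⊤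
                             r , r↑ , t = isSearch D comp
                         in r , tree-chain t x∈ , r↑
    ; comparable = λ {x} xy → let D , comp , x∈ = component {U = ⊤} {x} ∈⊤
                                  r , r↑ , t = isSearch D comp
                   in tree-comparable t x∈ (comp-path comp x∈ ((∈⊤ , ∈⊤ , xy) ◅ ε)) xy
    ; joined     = joined
    }
    where
    open SearchTree T renaming (parent to π)
    joined : ∀ {x p} → π x ≡ just p → Path K (λ z → Chain π z p) x p
    joined {x} e with D , comp , x∈ ← component {U = ⊤} {x} ∈⊤ with isSearch D comp
    ... | r , r↑ , t with tree-joined t (comp-connected comp) x∈
    ... | inj₁ refl with () ← trans (sym r↑) e
    ... | inj₂ (_ , e′ , j) with refl ← just-injective (trans (sym e) e′) = j

  -- Linear extensions

  -- Only a child in front of its parent is forbidden. In an order of all vertices this already puts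
  -- each vertex behind all its ancestors.
  Before : Parents {n} → Rel (Fin n) 0ℓ
  Before π x y = x ≢ y × π x ≢ just y

  LinExt : Parents {n} → List (Fin n) → Set
  LinExt π = AllPairs (Before π)

  -- Every suffix of a linear extension of all vertices has this property; inductions over lists
  -- carry it in place of `Order`.
  DownClosed : Parents {n} → List (Fin n) → Set
  DownClosed π l = ∀ {x p} → p ∈ l → π x ≡ just p → x ∈ l

  linExt-resp : ∀ {π ρ} → π ≗ ρ → ∀ {l} → LinExt π l → LinExt ρ l
  linExt-resp π≗ρ = AllPairs.map (λ (x≢y , ¬e) → x≢y , ¬e ∘ trans (π≗ρ _))

  allPairs-perm : ∀ {R : Rel (Fin n) 0ℓ} l₁ {l m} → l ↭ m → (AllPairs R l → AllPairs R m) →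
                  AllPairs R (l₁ ++ l) → AllPairs R (l₁ ++ m)
  allPairs-perm []       _   f rs       = f rs
  allPairs-perm (x ∷ l₁) l↭m f (r ∷ rs) =
    All-resp-↭ (++⁺ˡ l₁ l↭m) r ∷ allPairs-perm l₁ l↭m f rs

  allPairs-front : ∀ {R : Rel (Fin n) 0ℓ} l₁ {x l} → All (R x) l₁ →
                   AllPairs R (l₁ ++ x ∷ l) → AllPairs R (x ∷ l₁ ++ l)
  allPairs-front []       _         rs              = rs
  allPairs-front (y ∷ l₁) {x} {l} (xy ∷ xl₁) (r ∷ rs)
    with allPairs-front l₁ xl₁ rs | All-resp-↭ (shift x l₁ l) r
  ... | r′ ∷ rs′ | _ ∷ yl = (xy ∷ r′) ∷ yl ∷ rs′

  par-tail : ∀ {y l x} → par (y ∷ l) x ≡ nothing → par l x ≡ nothing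
  par-tail {y} {l} {x} e with par l x
  ... | nothing = refl

  module _ {π : Parents {n}} where

    downClosed-tail : ∀ {y l} → LinExt π (y ∷ l) → DownClosed π (y ∷ l) → DownClosed π l
    downClosed-tail (r ∷ _) down p∈ e with down (there p∈) e
    ... | here refl = contradiction e (proj₂ (All.lookup r p∈))
    ... | there x∈  = x∈

    chain-down : ∀ {l x y} → DownClosed π l → y ∈ l → Chain π x y → x ∈ l
    chain-down down y∈ ε       = y∈
    chain-down down y∈ (e ◅ c) = down (chain-down down y∈ c) e

    module _ (O : IsSearchOrder π) where
      open IsSearchOrder O

      -- Adjacent vertices are comparable, so an edge that leaves the subtree of `s` ends in a
      -- proper ancestor of `s`, and these lie outside `P`.
      path-below : ∀ {P s x} → (∀ {p z} → π s ≡ just p → Chain π p z → ¬ P z) →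
                   Path K P s x → Chain π x s
      path-below {P} {s} top = go ε
        where
        go : ∀ {z x} → Chain π z s → Path K P z x → Chain π x s
        go zs ε = zs
        go zs (_◅_ {j = y} (_ , py , zy) p) with comparable zy
        ... | inj₂ yz = go (yz ◅◅ zs) p
        ... | inj₁ zy with chain-linear zs zy
        ... | inj₂ ys = go ys p
        ... | inj₁ sy with s ≟ y
        ... | yes refl = go ε p
        ... | no s≢y with q , e , qy ← chain-up sy s≢y = contradiction py (top e qy)

      top-first : ∀ {y l} → DownClosed π (y ∷ l) → LinExt π (y ∷ l) →
                  ∀ {p z} → π y ≡ just p → Chain π p z → z ∉ y ∷ l
      top-first down (r ∷ _) e c z∈ with chain-down down z∈ c
      ... | here refl = acyclic e
      ... | there p∈  = proj₂ (All.lookup r p∈) e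

      -- If `par` gives `x` the parent `y`, then `x` is below `y` by `path-below`, so its true
      -- parent is `y` or in `l`; `par-nothing` excludes the latter. Conversely, if the true parent
      -- is `y`, then `joined` gives a path inside the subtree of `y`, which is contained in the
      -- list, so `par` finds it.
      par-just    : ∀ {l} → DownClosed π l → LinExt π l →
                    ∀ {x p} → par l x ≡ just p → π x ≡ just p
      par-nothing : ∀ {l} → DownClosed π l → LinExt π l →
                    ∀ {x p} → x ∈ l → par l x ≡ nothing → p ∈ l → π x ≢ just p

      par-just {y ∷ l} down lin@(r ∷ rs) e with par-inv {l = l} e
      ... | inj₁ e′ = par-just (downClosed-tail lin down) rs e′
      ... | inj₂ (e′ , refl , x∈ , p)
          with chain-up (path-below (top-first down lin) (path-sym p)) (proj₁ (All.lookup r x∈) ∘ sym)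
      ... | q , f , c with chain-down down (here refl) c
      ... | here refl = f
      ... | there q∈  = contradiction f (par-nothing (downClosed-tail lin down) rs x∈ e′ q∈)

      par-nothing {y ∷ l} down lin@(r ∷ rs) (here refl) _ (here refl) f = acyclic f
      par-nothing {y ∷ l} down lin@(r ∷ rs) (here refl) _ (there p∈)  f = proj₂ (All.lookup r p∈) f
      par-nothing {y ∷ l} down lin@(r ∷ rs) (there x∈) e (there p∈) f =
        par-nothing (downClosed-tail lin down) rs x∈ (par-tail e) p∈ f
      par-nothing {y ∷ l} down lin@(r ∷ rs) (there x∈) e (here refl) f
        with () ← trans (sym e) (par-here (par-tail e)
                    (x∈ , path-mono (chain-down down (here refl)) (joined f)))

      linExt-par : ∀ {l} → Order l → LinExt π l → par l ≗ π
      linExt-par {l} ord lin x with par l x in e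
      ... | just _ = sym (par-just (λ _ _ → order-∈ ord _) lin e)
      ... | nothing with π x in f
      ... | nothing = refl
      ... | just _  = contradiction f
        (par-nothing (λ _ _ → order-∈ ord _) lin (order-∈ ord _) e (order-∈ ord _))

      -- A child is one deeper than its parent, so sorting by depth puts parents first.
      linExt-exists : ∃ λ l → Order l × LinExt π l
      linExt-exists = sort (allFin n) , sort-↭ _ ,
        AllPairs.zipWith
          (λ {x} {y} (x≢y , le) → x≢y , λ e → 1+n≰n (subst (_≤ depth y) (depth-parent e) le))
          (order-unique (sort-↭ _) , Sorted⇒AllPairs (DecTotalOrder.totalOrder byDepth) (sort-↗ _))
        where
        byDepth : DecTotalOrder 0ℓ 0ℓ 0ℓ
        byDepth = On.decTotalOrder ≤-decTotalOrder depth
        open Sort byDepth using (sort; sort-↭; sort-↗)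

  par-linExt : ∀ {l} → Unique l → LinExt (par l) l
  par-linExt {[]}    []          = []
  par-linExt {y ∷ l} (y≢ ∷ uniq) =
    All.map (λ {z} y≢z → y≢z , λ e → contradiction (trans (sym (par-first y∉)) e) λ ()) y≢ ∷
    later (par-linExt uniq) y≢
    where
    y∉ : y ∉ l
    y∉ y∈ = All.lookup y≢ y∈ refl
    later : ∀ {m} → LinExt (par l) m → All (y ≢_) m → LinExt (par (y ∷ l)) m
    later []       _         = []
    later (r ∷ rs) (_ ∷ y≢) =
      All.zipWith (λ {z} ((x≢z , ¬e) , y≢z) → x≢z , case z ¬e y≢z ∘ par-inv {l = l}) (r , y≢) ∷
      later rs y≢
      where
      case : ∀ {x} z → par l x ≢ just z → y ≢ z →
             ¬ (par l x ≡ just z ⊎ (par l x ≡ nothing × z ≡ y × Below y l x))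
      case z ¬e _   (inj₁ e)              = ¬e e
      case z _  y≢z (inj₂ (_ , refl , _)) = y≢z refl

  -- Exchanging consecutive vertices

  -- The index is the cost; any exchange may be paid for, even if it could be free.
  data Swap : ℕ → Rel (List (Fin n)) 0ℓ where
    free : ∀ {a b l} → ¬ Path K (_∈ a ∷ b ∷ l) a b → Swap 0 (a ∷ b ∷ l) (b ∷ a ∷ l)
    paid : ∀ {a b l} → Swap 1 (a ∷ b ∷ l) (b ∷ a ∷ l)
    skip : ∀ {c x l m} → Swap c l m → Swap c (x ∷ l) (x ∷ m)

  data Swaps : ℕ → Rel (List (Fin n)) 0ℓ where
    []  : ∀ {l} → Swaps 0 l l
    _∷_ : ∀ {c d l m r} → Swap c l m → Swaps d m r → Swaps (c + d) l r

  swap-↭ : ∀ {c l m} → Swap c l m → l ↭ m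
  swap-↭ (free _) = ↭.swap _ _ ↭-refl
  swap-↭ paid     = ↭.swap _ _ ↭-refl
  swap-↭ (skip s) = ↭.prep _ (swap-↭ s)

  swaps-↭ : ∀ {c l m} → Swaps c l m → l ↭ m
  swaps-↭ []       = ↭-refl
  swaps-↭ (s ∷ ss) = ↭-trans (swap-↭ s) (swaps-↭ ss)

  _++ˢ_ : ∀ {c d l m r} → Swaps c l m → Swaps d m r → Swaps (c + d) l r
  []       ++ˢ ts = ts
  _++ˢ_ {r = r} (_∷_ {c} {d} {l} s ss) ts =
    subst (λ k → Swaps k l r) (sym (+-assoc c d _)) (s ∷ (ss ++ˢ ts))

  skips : ∀ {c x l m} → Swaps c l m → Swaps c (x ∷ l) (x ∷ m)
  skips []       = []
  skips (s ∷ ss) = skip s ∷ skips ss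

  paid-after : ∀ l₁ {a b l} → Swap 1 (l₁ ++ a ∷ b ∷ l) (l₁ ++ b ∷ a ∷ l)
  paid-after []       = paid
  paid-after (_ ∷ l₁) = skip (paid-after l₁)

  -- Free exchanges between the linear extensions of one tree.

  downClosed-↭ : ∀ {π : Parents {n}} {l m} → l ↭ m → DownClosed π l → DownClosed π m
  downClosed-↭ l↭m down p∈ e = ∈-resp-↭ l↭m (down (∈-resp-↭ (↭-sym l↭m) p∈) e)

  module _ {π : Parents {n}} (O : IsSearchOrder π) where
    open IsSearchOrder O

    -- A path would put `b` below `a`. The parent of `b` would then be in the list, but it is not
    -- `a`, not `b` itself, and not a vertex behind `b`.
    incomparable-apart : ∀ {a b l} → DownClosed π (a ∷ b ∷ l) → LinExt π (a ∷ b ∷ l) →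
                         Before π b a → ¬ Path K (_∈ a ∷ b ∷ l) a b
    incomparable-apart down lin@(_ ∷ r ∷ _) (b≢a , ¬e) p
      with q , e , c ← chain-up (path-below O (top-first O down lin) p) b≢a
      with chain-down down (here refl) c
    ... | here refl         = ¬e e
    ... | there (here refl) = acyclic e
    ... | there (there q∈)  = proj₂ (All.lookup r q∈) e

    move-front : ∀ l₁ {x l} → DownClosed π (l₁ ++ x ∷ l) → LinExt π (l₁ ++ x ∷ l) →
                 All (Before π x) l₁ → Swaps 0 (l₁ ++ x ∷ l) (x ∷ l₁ ++ l)
    move-front []       _ _ _ = []
    move-front (z ∷ l₁) {x} {l} down lin@(r ∷ rs) (xz ∷ xl₁) =
      skips (move-front l₁ (downClosed-tail lin down) rs xl₁) ++ˢ
      (free (incomparable-apart (downClosed-↭ z∷shift down)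
               (All-resp-↭ (shift x l₁ l) r ∷ allPairs-front l₁ xl₁ rs) xz) ∷ [])
      where
      z∷shift : z ∷ l₁ ++ x ∷ l ↭ z ∷ x ∷ l₁ ++ l
      z∷shift = ↭.prep z (shift x l₁ l)

    -- Selection sort: the head `x` of `m` is brought to the front of `l`. The vertices it passes
    -- come after it in `m`, so its parent is not among them and each exchange is free.
    linExts-free : ∀ {l m} → l ↭ m → DownClosed π l → LinExt π l → LinExt π m → Swaps 0 l m
    linExts-free {m = []} l↭ _ _ _ with refl ← ↭-empty-inv l↭ = []
    linExts-free {m = x ∷ m} l↭ down lin (r ∷ rs)
      with l₁ , l₂ , refl ← ∈-∃++ (∈-resp-↭ (↭-sym l↭) (here refl))
      = move-front l₁ down lin xl₁ ++ˢ
        skips (linExts-free l↭m (downClosed-tail lin′ down′) (AllPairs.tail lin′) rs)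
      where
      l↭m : l₁ ++ l₂ ↭ m
      l↭m = drop-∷ (↭-trans (↭-sym (shift x l₁ l₂)) l↭)
      xl₁ : All (Before π x) l₁
      xl₁ = ++⁻ˡ l₁ (All-resp-↭ (↭-sym l↭m) r)
      lin′ : LinExt π (x ∷ l₁ ++ l₂)
      lin′ = allPairs-front l₁ xl₁ lin
      down′ : DownClosed π (x ∷ l₁ ++ l₂)
      down′ = downClosed-↭ (shift x l₁ l₂) down

    -- In any linear extension `v` can be moved forward until it follows `u`: none of the vertices
    -- that it passes is its parent, which is `u`.
    child-next : ∀ {u v} → π v ≡ just u →
                 ∃₂ λ l₁ l₂ → Order (l₁ ++ u ∷ v ∷ l₂) × LinExt π (l₁ ++ u ∷ v ∷ l₂)
    child-next {u} {v} e with l , ord , lin ← linExt-exists O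
      with l₁ , l₂ , refl ← ∈-∃++ (order-∈ ord u) with split l₁ lin (order-∈ ord v)
      where
      split : ∀ l₁ {l₂} → LinExt π (l₁ ++ u ∷ l₂) → v ∈ l₁ ++ u ∷ l₂ → v ∈ l₂
      split []       _        (here refl) = contradiction e acyclic
      split []       _        (there v∈)  = v∈
      split (_ ∷ l₁) (r ∷ _)  (here refl) = contradiction e (proj₂ (All.lookup r (∈-insert l₁)))
      split (_ ∷ l₁) (_ ∷ rs) (there v∈)  = split l₁ rs v∈
    ... | v∈ with m , l₃ , refl ← ∈-∃++ v∈
      = l₁ , m ++ l₃ , ↭-trans (++⁺ˡ l₁ (↭.prep u (↭-sym (shift v m l₃)))) ord
      , allPairs-perm l₁ (↭.prep u (shift v m l₃)) next lin
      where
      next : LinExt π (u ∷ m ++ v ∷ l₃) → LinExt π (u ∷ v ∷ m ++ l₃)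
      next (r ∷ rs) =
        All-resp-↭ (shift v m l₃) r ∷ allPairs-front m (before-m m rs (All.map proj₁ r)) rs
        where
        before-m : ∀ m → LinExt π (m ++ v ∷ l₃) → All (u ≢_) (m ++ v ∷ l₃) → All (Before π v) m
        before-m []      _        _        = []
        before-m (z ∷ m) (r ∷ rs) (u≢z ∷ u≢) =
          ((λ { refl → proj₁ (All.lookup r (∈-insert m)) refl })
          , λ e′ → u≢z (just-injective (trans (sym e) e′)))
          ∷ before-m m rs u≢

  -- From rotations to exchanges.

  exchange-linExt : ∀ {u v T T′} → IsRotation u v T T′ → ∀ l₁ {l₂} →
                    LinExt (parent T) (l₁ ++ u ∷ v ∷ l₂) → LinExt (parent T′) (l₁ ++ v ∷ u ∷ l₂)
  exchange-linExt {u} {v} {T} {T′} R = go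
    where
    open IsRotation R
    open IsSearchOrder (isSearchOrder T) using (acyclic)
    -- A vertex in front of `v` is not a child of `v`, so `rest` keeps its parent.
    top : ∀ {x y} → x ≢ u → x ≢ v → Before (parent T) x v →
          Before (parent T) x y → Before (parent T′) x y
    top x≢u x≢v (_ , ¬xv) (x≢y , ¬xy) = x≢y , ¬xy ∘ trans (sym (rest _ x≢u x≢v ¬xv))
    bottom : ∀ {x y} → x ≢ u → x ≢ v → y ≢ u → y ≢ v →
             Before (parent T) x y → Before (parent T′) x y
    bottom {x} x≢u x≢v y≢u y≢v (x≢y , ¬xy) =
      x≢y , λ e → ¬xy (trans (sym (rest x x≢u x≢v (¬child e))) e)
      where
      ¬child : parent T′ x ≡ just _ → parent T x ≢ just v
      -- A child of `v` ends up below `u` or `v`, neither of which is `y`. The adjacency is not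
      -- decided: `move` refutes it, and the refutation is what `stay` asks for.
      ¬child e xv = y≢v (just-injective (trans (sym e) (stay x xv
        λ adj → y≢u (just-injective (trans (sym e) (move x xv adj))))))
    bottoms : ∀ {l} → All (Before (parent T) u) l → All (Before (parent T) v) l →
              LinExt (parent T) l → LinExt (parent T′) l
    bottoms []               []               []       = []
    bottoms ((u≢x , _) ∷ us) ((v≢x , _) ∷ vs) (r ∷ rs) =
      All.zipWith (λ (((u≢y , _) , (v≢y , _)) , xy) →
          bottom (u≢x ∘ sym) (v≢x ∘ sym) (u≢y ∘ sym) (v≢y ∘ sym) xy)
        (All.zip (us , vs) , r)
      ∷ bottoms us vs rs
    go : ∀ l₁ {l₂} → LinExt (parent T) (l₁ ++ u ∷ v ∷ l₂) → LinExt (parent T′) (l₁ ++ v ∷ u ∷ l₂)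
    go []       (((u≢v , _) ∷ us) ∷ vs ∷ rs) =
      ((u≢v ∘ sym , acyclic ∘ trans (sym upper)) ∷
        All.zipWith (λ ((v≢x , _) , (_ , ¬ux)) → v≢x , ¬ux ∘ trans (sym upper)) (vs , us)) ∷
      All.zipWith (λ ((u≢x , _) , (v≢x , _)) → u≢x , v≢x ∘ just-injective ∘ trans (sym lower))
        (us , vs) ∷
      bottoms us vs rs
    go (x ∷ l₁) (r ∷ rs) =
      All.map (top (proj₁ xu) (proj₁ xv) xv) (All-resp-↭ (++⁺ˡ l₁ (↭.swap u v ↭-refl)) r) ∷ go l₁ rs
      where
      xu = All.lookup r (∈-++⁺ʳ l₁ (here refl))
      xv = All.lookup r (∈-++⁺ʳ l₁ (there (here refl)))

  free-swaps : ∀ (T : SearchTree K) {l m} → Order l → LinExt (parent T) l →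
               Order m → LinExt (parent T) m → Swaps 0 l m
  free-swaps T ol linl om linm =
    linExts-free (isSearchOrder T) (↭-trans ol (↭-sym om)) (λ _ _ → order-∈ ol _) linl linm

  -- The detour through an order with `u` and `v` consecutive is free on both sides, so only the
  -- exchange of these two is paid. The reverse direction serves the `bwd` edges of the symmetric
  -- closure.
  rotation⇒swaps : ∀ {u v T T′ l m} → IsRotation u v T T′ →
                   Order l → LinExt (parent T) l → Order m → LinExt (parent T′) m →
                   Swaps 1 l m × Swaps 1 m l
  rotation⇒swaps {T = T} {T′} R ol linl om linm
    with l₁ , l₂ , o , lin ← child-next (isSearchOrder T) (IsRotation.child R)
    = (free-swaps T ol linl o lin ++ˢ (paid-after l₁ ∷ free-swaps T′ o′ lin′ om linm))
    , (free-swaps T′ om linm o′ lin′ ++ˢ (paid-after l₁ ∷ free-swaps T o lin ol linl))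
    where
    o′ : Order (l₁ ++ _ ∷ _ ∷ l₂)
    o′ = ↭-trans (↭-sym (swap-↭ (paid-after l₁))) o
    lin′ : LinExt (parent T′) (l₁ ++ _ ∷ _ ∷ l₂)
    lin′ = exchange-linExt R l₁ lin

  walk⇒swaps : ∀ {k T T′ l m} → Walk (𝓡 K) k T T′ →
               Order l → LinExt (parent T) l → Order m → LinExt (parent T′) m → Swaps k l m
  walk⇒swaps {T = T} (nil T≈T′) ol linl om linm =
    free-swaps T ol linl om (linExt-resp (sym ∘ T≈T′) linm)
  walk⇒swaps (cons {y = T₁} E w) ol linl om linm
    with l₁ , o₁ , lin₁ ← linExt-exists (isSearchOrder T₁) with E
  ... | fwd (_ , _ , R) = proj₁ (rotation⇒swaps R ol linl o₁ lin₁) ++ˢ walk⇒swaps w o₁ lin₁ om linm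
  ... | bwd (_ , _ , R) = proj₂ (rotation⇒swaps R o₁ lin₁ ol linl) ++ˢ walk⇒swaps w o₁ lin₁ om linm

  -- From exchanges to rotations.

  nothing-or-just : ∀ {A : Set} (m : Maybe A) → m ≡ nothing ⊎ ∃ λ x → m ≡ just x
  nothing-or-just nothing  = inj₁ refl
  nothing-or-just (just x) = inj₂ (x , refl)

  -- `IsRotation` for bare parent maps, since those of suffixes need not be search trees on `K`. The
  -- adjacency condition is a parameter `A`, which stays fixed while vertices are added in front.
  record Rotated (u v : Fin n) (A : Pred (Fin n) 0ℓ) (π π′ : Parents {n}) : Set where
    field
      child : π v ≡ just u
      upper : π′ v ≡ π u
      lower : π′ u ≡ just v
      move  : ∀ s → π s ≡ just v → A s → π′ s ≡ just u
      stay  : ∀ s → π s ≡ just v → ¬ A s → π′ s ≡ just v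
      rest  : ∀ x → x ≢ u → x ≢ v → π x ≢ just v → π′ x ≡ π x

  AdjacentWithin : Fin n → List (Fin n) → Pred (Fin n) 0ℓ
  AdjacentWithin a l s = ∃ λ x → Path K (_∈ l) s x × Adj a x

  par-cong : ∀ {y l m x z} → par l x ≡ par m z → (Below y l x → Below y m z) →
             (Below y m z → Below y l x) → par (y ∷ l) x ≡ par (y ∷ m) z
  par-cong {y} {l} {m} {x} {z} e f g with par l x in e₁ | par m z in e₂
  ... | just _  | just _  = e
  ... | nothing | nothing with below? y l x | below? y m z
  ... | yes _ | yes _ = refl
  ... | no _  | no _  = refl
  ... | yes b | no ¬b = contradiction (f b) ¬b
  ... | no ¬b | yes b = contradiction (g b) ¬b

  path-snoc : ∀ {a l x z} → z ∈ l → Path K (_∈ l) x z → Adj a z → Path K (_∈ a ∷ l) x a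
  path-snoc z∈ p az = path-mono there p ◅◅ (there z∈ , here refl , Graph.sym K az) ◅ ε

  -- The children of `b` are roots of `par l` joined to `b`. After the exchange `a` is tried before
  -- `b`: it takes those whose component in `l` is adjacent to `a`, and the others are left to `b`.
  exchange-front : ∀ {a b l} → Unique (a ∷ b ∷ l) → Path K (_∈ a ∷ b ∷ l) a b →
                   Rotated a b (AdjacentWithin a l) (par (a ∷ b ∷ l)) (par (b ∷ a ∷ l))
  exchange-front {a} {b} {l} ((a≢b ∷ a≢) ∷ b≢ ∷ _) ab = record
    { child = par-here (par-first b∉) (here refl , path-sym ab)
    ; upper = trans (par-first λ { (here b≡a) → a≢b (sym b≡a) ; (there b∈) → b∉ b∈ })
                    (sym (par-first a∉b∷l))
    ; lower = par-here (par-first a∉) (here refl , path-mono swap-∈ ab)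
    ; move  = λ s e (x , sx , ax) → let e₀ , s∈ , _ = child-inv e in
                par-there (par-here e₀ (s∈ , path-snoc (path-end s∈ sx) sx ax))
    ; stay  = λ s e ¬adj → let e₀ , s∈ , sb = child-inv e in
                par-here (par-none e₀ λ (_ , sa) → case-last ¬adj (path-last s∈ a∉ sa))
                  (there s∈ , path-mono insert-∈ sb)
    ; rest  = rest
    }
    where
    a∉ : a ∉ l
    a∉ a∈ = All.lookup a≢ a∈ refl
    b∉ : b ∉ l
    b∉ b∈ = All.lookup b≢ b∈ refl
    a∉b∷l : a ∉ b ∷ l
    a∉b∷l (here a≡b) = a≢b a≡b
    a∉b∷l (there a∈) = a∉ a∈
    insert-∈ : ∀ {x y z} → z ∈ x ∷ l → z ∈ x ∷ y ∷ l
    insert-∈ (here e)   = here e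
    insert-∈ (there z∈) = there (there z∈)
    swap-∈ : ∀ {x y z} → z ∈ x ∷ y ∷ l → z ∈ y ∷ x ∷ l
    swap-∈ = ∈-resp-↭ (↭.swap _ _ ↭-refl)
    child-inv : ∀ {s} → par (a ∷ b ∷ l) s ≡ just b → par l s ≡ nothing × Below b l s
    child-inv e with par-inv {a} {b ∷ l} e
    ... | inj₂ (_ , b≡a , _) = contradiction (sym b≡a) a≢b
    ... | inj₁ e′ with par-inv {b} {l} e′
    ... | inj₁ e″           = contradiction (proj₂ (par-∈ {l} e″)) b∉
    ... | inj₂ (e₀ , _ , p) = e₀ , p
    case-last : ∀ {s} → ¬ AdjacentWithin a l s → ¬ (∃ λ z → z ∈ l × Path K (_∈ l) s z × Adj z a)
    case-last ¬adj (z , _ , p , za) = ¬adj (z , p , Graph.sym K za)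
    rest-nothing : ∀ {x} → x ≢ a → x ≢ b → par (a ∷ b ∷ l) x ≢ just b → par l x ≡ nothing →
                   Dec (Below b l x) → Dec (Below a (b ∷ l) x) →
                   par (b ∷ a ∷ l) x ≡ par (a ∷ b ∷ l) x
    rest-nothing x≢a x≢b ¬e e₀ (yes p) _ = contradiction (par-there (par-here e₀ p)) ¬e
    rest-nothing x≢a x≢b ¬e e₀ (no _) (yes (here x≡b , _)) = contradiction x≡b x≢b
    -- Up to its first arrival in `a` the path avoids `b`, so `a` is the parent of `x` in both maps.
    rest-nothing {x} x≢a x≢b ¬e e₀ (no ¬p) (yes (there x∈ , xa)) =
      trans (par-there (par-here e₀ (x∈ , xa′))) (sym (par-here (par-none e₀ ¬p) (there x∈ , xa)))
      where
      xa′ : Path K (_∈ a ∷ l) x a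
      xa′ with z , z∈ , xz , za ← path-last (there x∈) a∉b∷l xa
        = let xz′ = path-avoid (λ xb → ¬p (x∈ , xb)) xz
          in path-snoc (path-end x∈ xz′) xz′ (Graph.sym K za)
    -- If `x` were joined to `b` once `a` is present, `ab` would join it to `a` too.
    rest-nothing x≢a x≢b ¬e e₀ (no ¬p) (no ¬q) =
      trans (par-none (par-none e₀ λ (x∈ , xa) → ¬q (there x∈ , path-mono insert-∈ xa))
               λ { (here x≡a , _)  → x≢a x≡a
                 ; (there x∈ , xb) → ¬q (there x∈ , path-mono swap-∈ xb ◅◅ path-sym ab) })
            (sym (par-none (par-none e₀ ¬p) ¬q))
    rest : ∀ x → x ≢ a → x ≢ b → par (a ∷ b ∷ l) x ≢ just b → par (b ∷ a ∷ l) x ≡ par (a ∷ b ∷ l) x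
    rest x x≢a x≢b ¬e with nothing-or-just (par l x)
    ... | inj₂ (_ , e₀) =
      trans (par-there {b} (par-there {a} {l} e₀)) (sym (par-there {a} (par-there {b} {l} e₀)))
    ... | inj₁ e₀ = rest-nothing x≢a x≢b ¬e e₀ (below? b l x) (below? a (b ∷ l) x)

  -- Both lists have the same vertices, so `y` is joined to the same ones. Only `upper` compares
  -- different vertices, and as `u` and `v` are joined inside `l`, either both reach `y` or neither
  -- does.
  exchange-skip : ∀ {u v A y l m} → l ↭ m → u ∈ l → v ∈ l → y ∉ l → Path K (_∈ l) u v →
                  Rotated u v A (par l) (par m) → Rotated u v A (par (y ∷ l)) (par (y ∷ m))
  exchange-skip {u} {v} {A} {y} {l} {m} l↭m u∈ v∈ y∉ uv R = record
    { child = par-there child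
    ; upper = par-cong upper
                (λ (_ , p) → u∈ , path-mono there uv ◅◅ path-mono m⊆l p)
                (λ (_ , p) → to v∈ , path-mono (there ∘ to) (path-sym uv) ◅◅ path-mono l⊆m p)
    ; lower = par-there lower
    ; move  = λ s e → par-there ∘ move s (inner e)
    ; stay  = λ s e → par-there ∘ stay s (inner e)
    ; rest  = λ x x≢u x≢v ¬e → par-cong (rest x x≢u x≢v (¬e ∘ par-there))
                (λ (x∈ , p) → from x∈ , path-mono m⊆l p) (λ (x∈ , p) → to x∈ , path-mono l⊆m p)
    }
    where
    open Rotated R
    to : ∀ {z} → z ∈ l → z ∈ m
    to = ∈-resp-↭ l↭m
    from : ∀ {z} → z ∈ m → z ∈ l
    from = ∈-resp-↭ (↭-sym l↭m)
    l⊆m : ∀ {z} → z ∈ y ∷ l → z ∈ y ∷ m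
    l⊆m = ∈-resp-↭ (↭.prep y l↭m)
    m⊆l : ∀ {z} → z ∈ y ∷ m → z ∈ y ∷ l
    m⊆l = ∈-resp-↭ (↭.prep y (↭-sym l↭m))
    inner : ∀ {s} → par (y ∷ l) s ≡ just v → par l s ≡ just v
    inner e with par-inv {y} {l} e
    ... | inj₁ e′             = e′
    ... | inj₂ (_ , refl , _) = contradiction v∈ y∉

  exchange-rotated : ∀ l₁ {a b l} → Unique (l₁ ++ a ∷ b ∷ l) → Path K (_∈ a ∷ b ∷ l) a b →
                     Rotated a b (AdjacentWithin a l)
                       (par (l₁ ++ a ∷ b ∷ l)) (par (l₁ ++ b ∷ a ∷ l))
  exchange-rotated []       uniq ab = exchange-front uniq ab
  exchange-rotated (y ∷ l₁) {a} {b} (y≢ ∷ uniq) ab =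
    exchange-skip (++⁺ˡ l₁ (↭.swap a b ↭-refl))
      (∈-++⁺ʳ l₁ (here refl)) (∈-++⁺ʳ l₁ (there (here refl))) (λ y∈ → All.lookup y≢ y∈ refl)
      (path-mono (∈-++⁺ʳ l₁) ab) (exchange-rotated l₁ uniq ab)

  par-suffix : ∀ l₁ {l x q} → Unique (l₁ ++ l) → q ∈ l → par (l₁ ++ l) x ≡ just q → par l x ≡ just q
  par-suffix []       _           _  e = e
  par-suffix (y ∷ l₁) {l} (y≢ ∷ uniq) q∈ e with par-inv {y} {l₁ ++ l} e
  ... | inj₁ e′             = par-suffix l₁ uniq q∈ e′
  ... | inj₂ (_ , refl , _) = contradiction refl (All.lookup y≢ (∈-++⁺ʳ l₁ q∈))

  downClosed-suffix : ∀ {π : Parents {n}} l₁ {l} →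
                      LinExt π (l₁ ++ l) → DownClosed π (l₁ ++ l) → DownClosed π l
  downClosed-suffix []       _ down = down
  downClosed-suffix (_ ∷ l₁) lin@(_ ∷ lin′) down =
    downClosed-suffix l₁ lin′ (downClosed-tail lin down)

  linExt-suffix : ∀ {π : Parents {n}} l₁ {l} → LinExt π (l₁ ++ l) → LinExt π l
  linExt-suffix []       lin       = lin
  linExt-suffix (_ ∷ l₁) (_ ∷ lin) = linExt-suffix l₁ lin

  module _ {π : Parents {n}} (O : IsSearchOrder π) where
    open IsSearchOrder O

    chain⇒path : ∀ {l s x} → DownClosed π l → s ∈ l → Chain π x s → Path K (_∈ l) x s
    chain⇒path down s∈ ε       = ε
    chain⇒path down s∈ (e ◅ c) =
      path-mono (λ d → chain-down down s∈ (d ◅◅ c)) (joined e) ◅◅ chain⇒path down s∈ c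

  module _ (l₁ : List (Fin n)) {a b l}
           (ord : Order (l₁ ++ a ∷ b ∷ l)) (ord′ : Order (l₁ ++ b ∷ a ∷ l)) where
    private
      T  = tree (l₁ ++ a ∷ b ∷ l) ord
      T′ = tree (l₁ ++ b ∷ a ∷ l) ord′
      O  = isSearchOrder T
      lin : LinExt (parent T) (l₁ ++ a ∷ b ∷ l)
      lin = par-linExt (order-unique ord)
      down : DownClosed (parent T) (a ∷ b ∷ l)
      down = downClosed-suffix l₁ lin (λ _ _ → order-∈ ord _)

    -- For a child `s` of `b`, the component of `s` in `l` is the subtree of `s`: chains to `s` stay
    -- in the down-closed `l`, and a path in `l` meets no proper ancestor of `s`.
    exchange-joined : Path K (_∈ a ∷ b ∷ l) a b → IsRotation a b T T′
    exchange-joined ab = record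
      { child = child ; upper = upper ; lower = lower ; rest = rest
      ; move  = λ s e adj → move s e (within e adj)
      ; stay  = λ s e ¬adj → stay s e (¬adj ∘ subtree e)
      }
      where
      open Rotated (exchange-rotated l₁ (order-unique ord) ab)
      lin-b : LinExt (parent T) (b ∷ l)
      lin-b = AllPairs.tail (linExt-suffix l₁ lin)
      down-b : DownClosed (parent T) (b ∷ l)
      down-b = downClosed-tail (linExt-suffix l₁ lin) down
      down-l : DownClosed (parent T) l
      down-l = downClosed-tail lin-b down-b
      child-∈ : ∀ {s} → parent T s ≡ just b → s ∈ l
      child-∈ e with down-b (here refl) e
      ... | here refl = contradiction e (IsSearchOrder.acyclic O)
      ... | there s∈  = s∈
      within : ∀ {s} → parent T s ≡ just b → AdjacentToSubtree T a s → AdjacentWithin a l s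
      within e (x , xs , ax) = x , path-sym (chain⇒path O down-l (child-∈ e) xs) , ax
      subtree : ∀ {s} → parent T s ≡ just b → AdjacentWithin a l s → AdjacentToSubtree T a s
      subtree {s} e (x , sx , ax) = x , path-below O top sx , ax
        where
        top : ∀ {p z} → parent T s ≡ just p → Chain (parent T) p z → z ∉ l
        top e′ c z∈ with refl ← just-injective (trans (sym e) e′) =
          proj₁ (All.lookup (AllPairs.head lin-b) (chain-down down-l z∈ c)) refl

    -- If `b` were a child of `a`, they would be joined. So the exchanged order is still a linear
    -- extension of `T`, and determines the same parent map.
    exchange-apart : ¬ Path K (_∈ a ∷ b ∷ l) a b → parent T ≗ parent T′
    exchange-apart ¬ab = sym ∘ linExt-par O ord′ (allPairs-perm l₁ (↭.swap a b ↭-refl) exch lin)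
      where
      ¬child : a ∉ b ∷ l → parent T b ≢ just a
      ¬child a∉ e with par-inv {a} {b ∷ l} (par-suffix l₁ (order-unique ord) (here refl) e)
      ... | inj₁ e′              = a∉ (proj₂ (par-∈ {b ∷ l} e′))
      ... | inj₂ (_ , _ , _ , p) = ¬ab (path-sym p)
      exch : LinExt (parent T) (a ∷ b ∷ l) → LinExt (parent T) (b ∷ a ∷ l)
      exch (ra@((a≢b , _) ∷ ra′) ∷ rb ∷ rs) =
        ((a≢b ∘ sym , ¬child (λ a∈ → proj₁ (All.lookup ra a∈) refl)) ∷ rb) ∷ ra′ ∷ rs

  swap-view : ∀ {c l m} → Swap c l m → ∃ λ l₁ → ∃₂ λ a b → ∃ λ l₂ →
              l ≡ l₁ ++ a ∷ b ∷ l₂ × m ≡ l₁ ++ b ∷ a ∷ l₂ ×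
              (¬ Path K (_∈ a ∷ b ∷ l₂) a b ⊎ c ≡ 1)
  swap-view (free ¬ab) = [] , _ , _ , _ , refl , refl , inj₁ ¬ab
  swap-view paid       = [] , _ , _ , _ , refl , refl , inj₂ refl
  swap-view (skip s) with l₁ , a , b , l₂ , refl , refl , c ← swap-view s =
    _ ∷ l₁ , a , b , l₂ , refl , refl , c

  swap⇒rotation : ∀ {c l m} (ol : Order l) (om : Order m) → Swap c l m →
                  par l ≗ par m ⊎ (c ≡ 1 × ∃₂ λ a b → IsRotation a b (tree l ol) (tree m om))
  swap⇒rotation ol om s with swap-view s
  ... | l₁ , a , b , l₂ , refl , refl , inj₁ ¬ab  = inj₁ (exchange-apart l₁ ol om ¬ab)
  ... | l₁ , a , b , l₂ , refl , refl , inj₂ c≡1 with path? (_∈? (a ∷ b ∷ l₂)) a b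
  ... | yes ab = inj₂ (c≡1 , a , b , exchange-joined l₁ ol om ab)
  ... | no ¬ab = inj₁ (exchange-apart l₁ ol om ¬ab)

  -- Rotations and walks up to equality of parent maps.

  module _ {T T̃ : SearchTree K} (T≈T̃ : parent T ≗ parent T̃) where

    subtree-resp : ∀ {u s} → AdjacentToSubtree T u s → AdjacentToSubtree T̃ u s
    subtree-resp (x , xs , ux) = x , Star.map (trans (sym (T≈T̃ _))) xs , ux

  module _ {T T̃ T′ : SearchTree K} {u v : Fin n} (T≈T̃ : parent T ≗ parent T̃) where

    rotation-respˡ : IsRotation u v T T′ → IsRotation u v T̃ T′
    rotation-respˡ R = record
      { child = trans (sym (T≈T̃ v)) child
      ; upper = trans upper (T≈T̃ u)
      ; lower = lower
      ; move  = λ s e adj → move s (trans (T≈T̃ s) e) (subtree-resp {T̃} {T} (sym ∘ T≈T̃) adj)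
      ; stay  = λ s e ¬adj → stay s (trans (T≈T̃ s) e) (¬adj ∘ subtree-resp {T} {T̃} T≈T̃)
      ; rest  = λ x x≢u x≢v ¬e → trans (rest x x≢u x≢v (¬e ∘ trans (sym (T≈T̃ x)))) (T≈T̃ x)
      }
      where open IsRotation R

    rotation-respʳ : IsRotation u v T′ T → IsRotation u v T′ T̃
    rotation-respʳ R = record
      { child = child
      ; upper = trans (sym (T≈T̃ v)) upper
      ; lower = trans (sym (T≈T̃ u)) lower
      ; move  = λ s e adj → trans (sym (T≈T̃ s)) (move s e adj)
      ; stay  = λ s e ¬adj → trans (sym (T≈T̃ s)) (stay s e ¬adj)
      ; rest  = λ x x≢u x≢v ¬e → trans (sym (T≈T̃ x)) (rest x x≢u x≢v ¬e)
      }
      where open IsRotation R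

  walk-respˡ : ∀ {k T T̃ T′} → parent T ≗ parent T̃ → Walk (𝓡 K) k T T′ → Walk (𝓡 K) k T̃ T′
  walk-respˡ T≈T̃ (nil T≈T′) = nil λ x → trans (sym (T≈T̃ x)) (T≈T′ x)
  walk-respˡ T≈T̃ (cons (fwd (u , v , R)) w) = cons (fwd (u , v , rotation-respˡ T≈T̃ R)) w
  walk-respˡ T≈T̃ (cons (bwd (u , v , R)) w) = cons (bwd (u , v , rotation-respʳ T≈T̃ R)) w

  walk-respʳ : ∀ {k T T′ T̃} → parent T′ ≗ parent T̃ → Walk (𝓡 K) k T T′ → Walk (𝓡 K) k T T̃
  walk-respʳ T′≈T̃ (nil T≈T′) = nil λ x → trans (T≈T′ x) (T′≈T̃ x)
  walk-respʳ T′≈T̃ (cons E w) = cons E (walk-respʳ T′≈T̃ w)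

  -- The length may be less than the cost, because a `paid` exchange of vertices that are not joined
  -- leaves the tree as it is.
  swaps⇒walk : ∀ {c l m} (ol : Order l) (om : Order m) → Swaps c l m →
               ∃ λ k → k ≤ c × Walk (𝓡 K) k (tree l ol) (tree m om)
  swaps⇒walk ol om [] = 0 , z≤n , nil λ _ → refl
  swaps⇒walk ol om (_∷_ {c} {d} s ss)
    with o ← ↭-trans (↭-sym (swap-↭ s)) ol
    with k , k≤d , w ← swaps⇒walk o om ss | swap⇒rotation ol o s
  ... | inj₁ eq               = k , ≤-trans k≤d (m≤n+m d c) , walk-respˡ (sym ∘ eq) w
  ... | inj₂ (refl , a , b , R) = suc k , s≤s k≤d , cons (fwd (a , b , R)) w

-- Sums over lists and indicators.

total : (Fin n → ℕ) → List (Fin n) → ℕ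
total w l = sum (map w l)

total-↭ : ∀ (w : Fin n → ℕ) {l m} → l ↭ m → total w l ≡ total w m
total-↭ w l↭m = sum-↭ (map⁺ w l↭m)

indicator : {A : Set} → Dec A → ℕ
indicator a? = if does a? then 1 else 0

indicator-yes : {A : Set} (a? : Dec A) → A → indicator a? ≡ 1
indicator-yes (yes _) _ = refl
indicator-yes (no ¬a) a = contradiction a ¬a

indicator-no : {A : Set} (a? : Dec A) → ¬ A → indicator a? ≡ 0
indicator-no (no _)  _  = refl
indicator-no (yes a) ¬a = contradiction a ¬a

indicator-mono : {A B : Set} → (A → B) → (a? : Dec A) (b? : Dec B) → indicator a? ≤ indicator b?
indicator-mono f (no _)  _       = z≤n
indicator-mono f (yes _) (yes _) = s≤s z≤n
indicator-mono f (yes a) (no ¬b) = contradiction (f a) ¬b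

indicator-≤1 : {A : Set} (a? : Dec A) → indicator a? ≤ 1
indicator-≤1 (no _)  = z≤n
indicator-≤1 (yes _) = s≤s z≤n

-- The letters `α`, `β` and `α′`, `μ` are the threshold indicators of the first two entries of two
-- lists, and `s`, `s′` the counts behind them. If `μ` is 0, so is `α′`, and the total count gives
-- the claim; otherwise `μ` alone makes up for `α`.
larger-last : ∀ {α β α′ μ s s′} → α ≤ 1 → α′ ≤ μ → s ≤ s′ →
              α + (β + s) ≤ α′ + (μ + s′) → α + s ≤ μ + s′
larger-last {α} {β} {α′} {zero}  {s} α≤1 z≤n s≤s′ le = ≤-trans (+-monoʳ-≤ α (m≤n+m s β)) le
larger-last {α} {β} {α′} {suc μ}     α≤1 _   s≤s′ le = +-mono-≤ (≤-trans α≤1 (s≤s z≤n)) s≤s′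

total-mono : ∀ {w w′ : Fin n → ℕ} → (∀ x → w x ≤ w′ x) → ∀ l → total w l ≤ total w′ l
total-mono w≤w′ []      = z≤n
total-mono w≤w′ (x ∷ l) = +-mono-≤ (w≤w′ x) (total-mono w≤w′ l)

total-zero : ∀ {w : Fin n → ℕ} → (∀ x → w x ≡ 0) → ∀ l → total w l ≡ 0
total-zero w≡0 []      = refl
total-zero w≡0 (x ∷ l) = cong₂ _+_ (w≡0 x) (total-zero w≡0 l)

members : Subset n → List (Fin n) → ℕ
members W = total (λ x → indicator (x ∈ˢ? W))

members-allFin : ∀ (W : Subset n) → members W (allFin n) ≡ ∣ W ∣
members-allFin W = trans (cong sum (map-tabulate id (λ x → indicator (x ∈ˢ? W)))) (go W)
  where
  go : ∀ {n} (W : Subset n) → sum (List.tabulate (λ x → indicator (x ∈ˢ? W))) ≡ ∣ W ∣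
  go Vec.[]          = refl
  go (true  Vec.∷ W) = cong suc (go W)
  go (false Vec.∷ W) = go W

-- Lifting exchanges to the graph with the edges inside W

module Lifting {n : ℕ} (G : Graph n) (W : Subset n) (twins : PairwiseTrueTwins G W) where

  H : Graph n
  H = G −ᴱ E[ G , W ]

  open Graph using (Adj)
  open SearchTrees

  -- Equality once the labels in `W` are forgotten.
  _~_ : Rel (Fin n) 0ℓ
  x ~ y = x ≡ y ⊎ (x ∈ˢ W × y ∈ˢ W)

  ~-∈ : ∀ {x y} → x ~ y → x ∈ˢ W → y ∈ˢ W
  ~-∈ (inj₁ refl)     x∈ = x∈
  ~-∈ (inj₂ (_ , y∈)) _  = y∈

  ~-∈⁻ : ∀ {x y} → x ~ y → y ∈ˢ W → x ∈ˢ W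
  ~-∈⁻ (inj₁ refl)     y∈ = y∈
  ~-∈⁻ (inj₂ (x∈ , _)) _  = x∈

  ~-≡ : ∀ {x y} → x ~ y → y ∉ˢ W → x ≡ y
  ~-≡ (inj₁ x≡y)      _  = x≡y
  ~-≡ (inj₂ (_ , y∈)) y∉ = contradiction y∈ y∉

  -- Twins have the same neighbours outside `W`, and an edge with an end outside `W` is not deleted.
  twin-adj : ∀ {x x′ y} → x ~ x′ → y ∉ˢ W → Adj G x′ y → Adj H x y
  twin-adj (inj₁ refl) y∉ xy = xy , λ (_ , _ , y∈) → y∉ y∈
  twin-adj (inj₂ (x∈ , x′∈)) y∉ x′y with proj₁ (twins x′∈ x∈) (inj₂ x′y)
  ... | inj₁ refl = contradiction x∈ y∉
  ... | inj₂ xy   = xy , λ (_ , _ , y∈) → y∉ y∈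

  module _ {L L′ : List (Fin n)} (match : ∀ {y′} → y′ ∈ L′ → ∃ λ y → y ∈ L × y ~ y′) where

    -- The edges inside W are missing in H, but a step between twins can be skipped:
    -- the next vertex outside W is adjacent to all of W.
    path-outside : ∀ {x x′ b} → b ∉ˢ W → x ∈ L → x ~ x′ →
                   Path G (_∈ L′) x′ b → Path H (_∈ L) x b
    path-outside b∉ x∈ x~x′ ε with refl ← ~-≡ x~x′ b∉ = ε
    path-outside {x} {x′} b∉ x∈ x~x′ (_◅_ {j = y′} (_ , y′∈ , xy) p) with y′ ∈ˢ? W | x′ ∈ˢ? W
    ... | yes y′∈W | yes x′∈W = path-outside b∉ x∈ (inj₂ (~-∈⁻ x~x′ x′∈W , y′∈W)) p
    ... | yes y′∈W | no x′∉W
        with refl ← ~-≡ x~x′ x′∉W | y , y∈ , y~y′ ← match y′∈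
        = (x∈ , y∈ , Graph.sym H {y} {x} (twin-adj y~y′ x′∉W (Graph.sym G xy))) ◅
          path-outside b∉ y∈ y~y′ p
    ... | no y′∉W | _
        with y , y∈ , y~y′ ← match y′∈ with refl ← ~-≡ y~y′ y′∉W
        = (x∈ , y∈ , twin-adj x~x′ y′∉W xy) ◅ path-outside b∉ y∈ y~y′ p

    -- Contrapositively, an exchange not inside `W` that is free in `H` is free in `G`. One of `a`
    -- and `b` lies outside `W`, as `path-outside` asks of its end; if it is `a`, the path is
    -- reversed.
    path-descend : ∀ {a a′ b b′} → ¬ (a ∈ˢ W × b ∈ˢ W) → a ∈ L → b ∈ L → a ~ a′ → b ~ b′ →
                   Path G (_∈ L′) a′ b′ → Path H (_∈ L) a b
    path-descend {a} {b = b} ¬ab a∈ b∈ a~ b~ p with b ∈ˢ? W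
    ... | no b∉W with refl ← ~-≡ b~ (b∉W ∘ ~-∈⁻ b~) = path-outside b∉W a∈ a~ p
    ... | yes b∈W with refl ← ~-≡ a~ (λ a∈W → ¬ab (~-∈⁻ a~ a∈W , b∈W)) =
      path-sym H (path-outside (λ a∈W → ¬ab (a∈W , b∈W)) b∈ b~ (path-sym G p))

  -- Sorting the labels in `W` by rank.

  module Sorting (rank : Fin n → ℕ) where

    above : ℕ → Fin n → ℕ
    above c x = indicator (c ≤? rank x)

    above-mono : ∀ c {x y} → rank x ≤ rank y → above c x ≤ above c y
    above-mono c le = indicator-mono (λ c≤ → ≤-trans c≤ le) (c ≤? _) (c ≤? _)

    inverted? : ∀ x y → Dec (x ∈ˢ W × y ∈ˢ W × rank y < rank x)
    inverted? x y = (x ∈ˢ? W) ×-dec (y ∈ˢ? W) ×-dec (rank y <? rank x)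

    inversion : Fin n → Fin n → ℕ
    inversion x y = indicator (inverted? x y)

    inversions : List (Fin n) → ℕ
    inversions []      = 0
    inversions (x ∷ l) = total (inversion x) l + inversions l

    inversions-swap : ∀ a b l → inversion b a + inversions (a ∷ b ∷ l) ≡
                                inversion a b + inversions (b ∷ a ∷ l)
    inversions-swap a b l = solve 5 (λ ba ab al bl i →
      ba :+ ((ab :+ al) :+ (bl :+ i)) := ab :+ ((ba :+ bl) :+ (al :+ i))) refl
      (inversion b a) (inversion a b) (total (inversion a) l) (total (inversion b) l) (inversions l)

    -- ρ is at least as sorted as σ, and differs from it only inside W.  This is
    -- the Bruhat order, each threshold c reducing it to sequences of 0s and 1s.
    data _≼_ : Rel (List (Fin n)) 0ℓ where
      []   : [] ≼ []
      cons : ∀ {x y σ ρ} → x ~ y → (∀ c → total (above c) (x ∷ σ) ≤ total (above c) (y ∷ ρ)) →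
             σ ≼ ρ → (x ∷ σ) ≼ (y ∷ ρ)

    ≼-refl : ∀ {σ} → σ ≼ σ
    ≼-refl {[]}    = []
    ≼-refl {_ ∷ _} = cons (inj₁ refl) (λ _ → ≤-refl) ≼-refl

    ≼-total : ∀ {σ ρ} → σ ≼ ρ → ∀ c → total (above c) σ ≤ total (above c) ρ
    ≼-total []           c = z≤n
    ≼-total (cons _ t _) c = t c

    ≼-match : ∀ {σ ρ} → σ ≼ ρ → ∀ {y} → y ∈ ρ → ∃ λ x → x ∈ σ × x ~ y
    ≼-match (cons x~y _ _) (here refl) = _ , here refl , x~y
    ≼-match (cons _ _ s) (there y∈) with x , x∈ , x~y ← ≼-match s y∈ = x , there x∈ , x~y

    -- The pair `a″`, `b″` is `a′`, `b′` in either order, according to whether the exchange is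
    -- performed on the right. Counts that include both entries do not change, so only those from
    -- the second entry on need `le`.
    ≼-exchange : ∀ {a b a′ b′ σ ρ a″ b″} → a″ ∷ b″ ∷ ρ ↭ a′ ∷ b′ ∷ ρ →
                 b ~ a″ → a ~ b″ →
                 (∀ c → total (above c) (a ∷ σ) ≤ total (above c) (b″ ∷ ρ)) →
                 (a ∷ b ∷ σ) ≼ (a′ ∷ b′ ∷ ρ) → (b ∷ a ∷ σ) ≼ (a″ ∷ b″ ∷ ρ)
    ≼-exchange {a} {b} {a′} {b′} {σ} {ρ} {a″} {b″} perm b~ a~ le (cons _ t (cons _ _ s)) =
      cons b~ (λ c → begin
        total (above c) (b ∷ a ∷ σ)   ≡⟨ total-↭ (above c) (↭.swap b a (↭-refl {x = σ})) ⟩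
        total (above c) (a ∷ b ∷ σ)   ≤⟨ t c ⟩
        total (above c) (a′ ∷ b′ ∷ ρ) ≡⟨ total-↭ (above c) perm ⟨
        total (above c) (a″ ∷ b″ ∷ ρ) ∎) (cons a~ le s)
      where open ≤-Reasoning

    larger-first : ∀ {a b x y σ ρ} → rank x ≤ rank y → σ ≼ ρ →
                   (∀ c → total (above c) (a ∷ b ∷ σ) ≤ total (above c) (x ∷ y ∷ ρ)) →
                   ∀ c → total (above c) (a ∷ σ) ≤ total (above c) (y ∷ ρ)
    larger-first {a} {b} le s t c =
      larger-last {β = above c b} (indicator-≤1 (c ≤? rank a)) (above-mono c le) (≼-total s c) (t c)

    -- The label outside `W` is the same on both sides: if it is `a`, it is added to the counts
    -- behind the pair; if it is `b`, it is cancelled from the counts that include the pair. A pair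
    -- not inside `W` is never an inversion.
    exchange-outside : ∀ {a b a′ b′ σ ρ} → ¬ (a ∈ˢ W × b ∈ˢ W) → (a ∷ b ∷ σ) ≼ (a′ ∷ b′ ∷ ρ) →
                       (b ∷ a ∷ σ) ≼ (b′ ∷ a′ ∷ ρ) ×
                       inversions (b′ ∷ a′ ∷ ρ) ≡ inversions (a′ ∷ b′ ∷ ρ)
    exchange-outside {a} {b} {a′} {b′} {σ} {ρ} ¬ab p@(cons a~ t (cons b~ _ s)) =
      ≼-exchange (↭.swap b′ a′ ↭-refl) b~ a~ le p ,
      sym (subst₂ (λ i j → i + inversions (a′ ∷ b′ ∷ ρ) ≡ j + inversions (b′ ∷ a′ ∷ ρ))
             b′a′≡0 a′b′≡0 (inversions-swap a′ b′ ρ))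
      where
      a′b′≡0 : inversion a′ b′ ≡ 0
      a′b′≡0 = indicator-no (inverted? a′ b′) λ (a∈ , b∈ , _) → ¬ab (~-∈⁻ a~ a∈ , ~-∈⁻ b~ b∈)
      b′a′≡0 : inversion b′ a′ ≡ 0
      b′a′≡0 = indicator-no (inverted? b′ a′) λ (b∈ , a∈ , _) → ¬ab (~-∈⁻ a~ a∈ , ~-∈⁻ b~ b∈)
      le : ∀ c → total (above c) (a ∷ σ) ≤ total (above c) (a′ ∷ ρ)
      le c with a ∈ˢ? W
      ... | no a∉ with refl ← ~-≡ a~ (a∉ ∘ ~-∈⁻ a~) = +-monoʳ-≤ (above c a) (≼-total s c)
      ... | yes a∈ with refl ← ~-≡ b~ (λ b∈ → ¬ab (a∈ , ~-∈⁻ b~ b∈)) =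
        +-cancelˡ-≤ (above c b) _ _ (begin
          above c b + (above c a + total (above c) σ)  ≡⟨ x∙yz≈y∙xz (above c b) (above c a) _ ⟩
          above c a + (above c b + total (above c) σ)  ≤⟨ t c ⟩
          above c a′ + (above c b + total (above c) ρ) ≡⟨ x∙yz≈y∙xz (above c a′) (above c b) _ ⟩
          above c b + (above c a′ + total (above c) ρ) ∎)
        where open ≤-Reasoning

    -- The comparator of a sorting network. An exchange that is performed costs 1 and removes one
    -- inversion; otherwise `ρ` stays and still matches, since `_~_` relates any two labels in `W`.
    exchange-inside : ∀ {a b σ ρ} → a ∈ˢ W → b ∈ˢ W → (a ∷ b ∷ σ) ≼ ρ →
                      ∃₂ λ k ρ′ → Swaps G k ρ ρ′ × (b ∷ a ∷ σ) ≼ ρ′ ×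
                                  k + inversions ρ′ ≤ inversions ρ
    exchange-inside {a} {b} {σ} a∈ b∈ p@(cons {y = a′} a~ t (cons {y = b′} {ρ = ρ} b~ _ s))
      with rank b′ <? rank a′
    ... | yes b<a = 1 , b′ ∷ a′ ∷ ρ , paid ∷ []
        , ≼-exchange (↭.swap b′ a′ ↭-refl) b~ a~ (larger-first {b = b} (<⇒≤ b<a) s t′) p
        , ≤-reflexive (sym
            (subst₂ (λ i j → i + inversions (a′ ∷ b′ ∷ ρ) ≡ j + inversions (b′ ∷ a′ ∷ ρ))
               b′a′≡0 a′b′≡1 (inversions-swap a′ b′ ρ)))
      where
      a′b′≡1 : inversion a′ b′ ≡ 1
      a′b′≡1 = indicator-yes (inverted? a′ b′) (~-∈ a~ a∈ , ~-∈ b~ b∈ , b<a)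
      b′a′≡0 : inversion b′ a′ ≡ 0
      b′a′≡0 = indicator-no (inverted? b′ a′) λ (_ , _ , a<b) → <-asym a<b b<a
      t′ : ∀ c → total (above c) (a ∷ b ∷ σ) ≤ total (above c) (b′ ∷ a′ ∷ ρ)
      t′ c = ≤-trans (t c)
        (≤-reflexive (total-↭ (above c) {m = b′ ∷ a′ ∷ ρ} (↭.swap a′ b′ ↭-refl)))
    ... | no b≮a = 0 , a′ ∷ b′ ∷ ρ , []
        , ≼-exchange ↭-refl (inj₂ (b∈ , ~-∈ a~ a∈)) (inj₂ (a∈ , ~-∈ b~ b∈))
            (larger-first {b = b} (≮⇒≥ b≮a) s t) p
        , ≤-refl

    -- The inversions serve as the potential of an amortised count: outside `W` cost and potential
    -- are copied, inside `W` the cost is covered by the inversions removed. Under `skip` the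
    -- inversions with the head `y` depend only on which labels follow it.
    lift-swap : ∀ {c σ σ′ ρ} → Swap H c σ σ′ → σ ≼ ρ →
                ∃₂ λ k ρ′ → Swaps G k ρ ρ′ × σ′ ≼ ρ′ × k + inversions ρ′ ≤ c + inversions ρ
    lift-swap {c} (skip s) (cons {y = y} {ρ = ρ} x~y t p)
      with k , ρ′ , ss , p′ , le ← lift-swap s p
      = k , y ∷ ρ′ , skips G ss ,
      cons x~y (λ d → subst₂ _≤_ (total-↭ (above d) (↭.prep _ (swap-↭ H s)))
                        (total-↭ (above d) (↭.prep y (swaps-↭ G ss))) (t d)) p′ ,
      (begin
        k + (total (inversion y) ρ′ + inversions ρ′) ≡⟨ x∙yz≈y∙xz k (total (inversion y) ρ′) _ ⟩
        total (inversion y) ρ′ + (k + inversions ρ′) ≤⟨ +-monoʳ-≤ (total (inversion y) ρ′) le ⟩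
        total (inversion y) ρ′ + (c + inversions ρ)  ≡⟨ cong (_+ (c + inversions ρ)) same ⟨
        total (inversion y) ρ + (c + inversions ρ)   ≡⟨ x∙yz≈y∙xz c (total (inversion y) ρ) _ ⟨
        c + (total (inversion y) ρ + inversions ρ)   ∎)
      where
      open ≤-Reasoning
      same : total (inversion y) ρ ≡ total (inversion y) ρ′
      same = total-↭ (inversion y) (swaps-↭ G ss)
    lift-swap (free {a} {b} ¬p) q@(cons a~ _ (cons b~ _ s)) with (a ∈ˢ? W) ×-dec (b ∈ˢ? W)
    ... | yes (a∈ , b∈) = exchange-inside a∈ b∈ q
    ... | no ¬ab with p′ , e ← exchange-outside ¬ab q =
      0 , _ , free (¬p ∘ path-descend (≼-match q) ¬ab (here refl) (there (here refl)) a~ b~) ∷ [] ,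
      p′ , ≤-reflexive e
    lift-swap (paid {a} {b}) q@(cons _ _ (cons _ _ _)) with (a ∈ˢ? W) ×-dec (b ∈ˢ? W)
    ... | yes (a∈ , b∈) with k , ρ′ , ss , p′ , le ← exchange-inside a∈ b∈ q =
      k , ρ′ , ss , p′ , ≤-trans le (m≤n+m _ 1)
    ... | no ¬ab with p′ , e ← exchange-outside ¬ab q =
      1 , _ , paid ∷ [] , p′ , ≤-reflexive (cong suc e)

    lift-swaps : ∀ {c σ τ ρ} → Swaps H c σ τ → σ ≼ ρ →
                 ∃₂ λ k ρ′ → Swaps G k ρ ρ′ × τ ≼ ρ′ × k + inversions ρ′ ≤ c + inversions ρ
    lift-swaps []       p = 0 , _ , [] , p , ≤-refl
    lift-swaps {ρ = ρ} (_∷_ {c} {d} s ss) p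
      with j , ρ₁ , ts , p₁ , le ← lift-swap s p
      with k , ρ₂ , us , p₂ , le′ ← lift-swaps ss p₁
      = j + k , ρ₂ , _++ˢ_ G ts us , p₂ , (begin
        j + k + inversions ρ₂   ≡⟨ +-assoc j k (inversions ρ₂) ⟩
        j + (k + inversions ρ₂) ≤⟨ +-monoʳ-≤ j le′ ⟩
        j + (d + inversions ρ₁) ≡⟨ x∙yz≈y∙xz j d (inversions ρ₁) ⟩
        d + (j + inversions ρ₁) ≤⟨ +-monoʳ-≤ d le ⟩
        d + (c + inversions ρ)  ≡⟨ x∙yz≈y∙xz d c (inversions ρ) ⟩
        c + (d + inversions ρ)  ≡⟨ +-assoc c d (inversions ρ) ⟨
        c + d + inversions ρ    ∎)
      where open ≤-Reasoning

    total-above : ∀ {c l} → All (λ x → c ≤ rank x) l → total (above c) l ≡ length l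
    total-above []         = refl
    total-above (le ∷ les) = cong₂ _+_ (indicator-yes (_ ≤? _) le) (total-above les)

    total-not-above : ∀ {c x l} → rank x < c → x ∈ l → total (above c) l < length l
    total-not-above {c} {x} {l = _ ∷ l} x<c (here refl)
      rewrite indicator-no (c ≤? rank x) (λ c≤x → <-irrefl refl (<-≤-trans x<c c≤x)) =
      s≤s (total-≤length l)
      where
      total-≤length : ∀ l → total (above c) l ≤ length l
      total-≤length []      = z≤n
      total-≤length (y ∷ l) = +-mono-≤ (indicator-≤1 (c ≤? rank y)) (total-≤length l)
    total-not-above {c} {l = y ∷ _} x<c (there x∈) =
      s≤s (≤-trans (+-monoˡ-≤ _ (indicator-≤1 (c ≤? rank y))) (total-not-above x<c x∈))

    -- Suppose that the head `x` of `σ`, which has the least rank, is in the tail of `ρ`. At the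
    -- threshold `suc (rank x)` the whole tail of `σ` is counted, but in the equally long tail of
    -- `ρ` the entry `x` is not.
    ≼-sorted : ∀ {σ ρ} → AllPairs (λ x y → rank x < rank y) σ → σ ↭ ρ → σ ≼ ρ → σ ≡ ρ
    ≼-sorted _ _ [] = refl
    ≼-sorted {x ∷ σ} {_ ∷ ρ} (r ∷ rs) perm (cons _ _ p) with ∈-resp-↭ perm (here refl)
    ... | here refl = cong (x ∷_) (≼-sorted rs (drop-∷ perm) p)
    ... | there x∈  = contradiction (begin-strict
      length σ                        ≡⟨ total-above r ⟨
      total (above (suc (rank x))) σ  ≤⟨ ≼-total p (suc (rank x)) ⟩
      total (above (suc (rank x))) ρ  <⟨ total-not-above ≤-refl x∈ ⟩
      length ρ                        ≡⟨ suc-injective (↭-length perm) ⟨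
      length σ                        ∎) (<-irrefl refl)
      where open ≤-Reasoning

    inversions-bound : ∀ l → inversions l ≤ members W l C 2
    inversions-bound []      = z≤n
    inversions-bound (x ∷ l) = step (x ∈ˢ? W)
      where
      open ≤-Reasoning
      m = members W l
      inversion-≤ : ∀ y → inversion x y ≤ indicator (y ∈ˢ? W)
      inversion-≤ y = indicator-mono (proj₁ ∘ proj₂) (inverted? x y) (y ∈ˢ? W)
      step : Dec (x ∈ˢ W) → inversions (x ∷ l) ≤ members W (x ∷ l) C 2
      step (yes x∈) = begin
        total (inversion x) l + inversions l  ≤⟨ +-mono-≤ (total-mono inversion-≤ l) (inversions-bound l) ⟩
        m + m C 2                             ≡⟨ cong (_+ m C 2) (nC1≡n m) ⟨
        m C 1 + m C 2                         ≡⟨ nCk+nC[k+1]≡[n+1]C[k+1] m 1 ⟩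
        suc m C 2                             ≡⟨ cong (λ k → (k + m) C 2) (indicator-yes (x ∈ˢ? W) x∈) ⟨
        members W (x ∷ l) C 2                 ∎
      step (no x∉) = begin
        total (inversion x) l + inversions l  ≡⟨ cong (_+ inversions l) (total-zero inversion-0 l) ⟩
        inversions l                          ≤⟨ inversions-bound l ⟩
        m C 2                                 ≡⟨ cong (λ k → (k + m) C 2) (indicator-no (x ∈ˢ? W) x∉) ⟨
        members W (x ∷ l) C 2                 ∎
        where
        inversion-0 : ∀ y → inversion x y ≡ 0
        inversion-0 y = indicator-no (inverted? x y) (x∉ ∘ proj₁)

-- The bound on the diameter.

position : List (Fin n) → Fin n → ℕ
position []      x = 0
position (y ∷ l) x = if does (x ≟ y) then 0 else suc (position l x)

position-sorted : ∀ {l : List (Fin n)} → Unique l → AllPairs (λ x y → position l x < position l y) l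
position-sorted []                  = []
position-sorted {l = x ∷ l} (x≢ ∷ uniq) = All.map first x≢ ∷ later (position-sorted uniq) x≢
  where
  position-later : ∀ {y} → x ≢ y → position (x ∷ l) y ≡ suc (position l y)
  position-later {y} x≢y with y ≟ x
  ... | yes refl = contradiction refl x≢y
  ... | no _     = refl
  first : ∀ {y} → x ≢ y → position (x ∷ l) x < position (x ∷ l) y
  first x≢y rewrite position-later x≢y with x ≟ x
  ... | yes _  = s≤s z≤n
  ... | no x≢x = contradiction refl x≢x
  later : ∀ {m} → AllPairs (λ y z → position l y < position l z) m → All (x ≢_) m →
          AllPairs (λ y z → position (x ∷ l) y < position (x ∷ l) z) m
  later []       _          = []
  later (r ∷ rs) (x≢y ∷ x≢) =
    All.zipWith (λ (lt , x≢z) →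
        subst₂ _<_ (sym (position-later x≢y)) (sym (position-later x≢z)) (s≤s lt))
      (r , x≢)
    ∷ later rs x≢

module _ (G : Graph n) (W : Subset n) (twins : PairwiseTrueTwins G W) where
  open Lifting G W twins
  open SearchTrees

  -- Ranks are positions in `τ`, which makes `τ` sorted. The lift starts from `σ` compared with
  -- itself and ends in some `ρ` with `τ ≼ ρ`, which `≼-sorted` identifies with `τ`.
  lift-orders : ∀ {c σ τ} → Order σ → Order τ → Swaps H c σ τ →
                ∃ λ k → k ≤ c + ∣ W ∣ C 2 × Swaps G k σ τ
  lift-orders {c} {σ} {τ} oσ oτ ss
    with k , ρ , ss′ , τ≼ρ , le ← Sorting.lift-swaps (position τ) ss (Sorting.≼-refl (position τ))
    with refl ← Sorting.≼-sorted (position τ) (position-sorted (order-unique oτ))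
                  (↭-trans oτ (↭-trans (↭-sym oσ) (swaps-↭ G ss′))) τ≼ρ
    = k , (begin
        k                      ≤⟨ m≤m+n k _ ⟩
        k + inversions τ       ≤⟨ le ⟩
        c + inversions σ       ≤⟨ +-monoʳ-≤ c (inversions-bound σ) ⟩
        c + members W σ C 2    ≡⟨ cong (λ m → c + m C 2) members-σ ⟩
        c + ∣ W ∣ C 2          ∎) , ss′
    where
    open ≤-Reasoning
    open Sorting (position τ) using (inversions; inversions-bound)
    members-σ : members W σ ≡ ∣ W ∣
    members-σ = trans (total-↭ (λ x → indicator (x ∈ˢ? W)) oσ) (members-allFin W)

  walk-bound : ∀ {d′} → IsDiameter (𝓡 H) d′ → ∀ T₁ T₂ →
               ∃ λ k → k ≤ d′ + ∣ W ∣ C 2 × Walk (𝓡 G) k T₁ T₂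
  walk-bound {d′} (distance , _) T₁ T₂
    with σ , oσ , σ-lin ← linExt-exists G (isSearchOrder G T₁)
    with τ , oτ , τ-lin ← linExt-exists G (isSearchOrder G T₂)
    with k′ , (w′ , _) , k′≤d′ ← distance (tree H σ oσ) (tree H τ oτ)
    with k , k≤ , ss ← lift-orders oσ oτ
           (walk⇒swaps H w′ oσ (par-linExt H (order-unique oσ))
                            oτ (par-linExt H (order-unique oτ)))
    with j , j≤k , w ← swaps⇒walk G oσ oτ ss
    = j , ≤-trans j≤k (≤-trans k≤ (+-monoˡ-≤ (∣ W ∣ C 2) k′≤d′))
    , walk-respˡ G (linExt-par G (isSearchOrder G T₁) oσ σ-lin)
        (walk-respʳ G (linExt-par G (isSearchOrder G T₂) oτ τ-lin) w)

  diameter-bound : ∀ {d d′} → IsDiameter (𝓡 G) d → IsDiameter (𝓡 H) d′ → d ≤ d′ + ∣ W ∣ C 2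
  diameter-bound {d} {d′} (_ , T₁ , T₂ , _ , shortest) diam = attained (walk-bound diam T₁ T₂)
    where
    attained : ∀ {m} → (∃ λ k → k ≤ m × Walk (𝓡 G) k T₁ T₂) → d ≤ m
    attained (k , k≤m , w) = ≤-trans (shortest k w) k≤m

⊖-bound : ∀ {m k} b → m ≤ k + b → + m - + b ≤ℤ + k
⊖-bound {m} {k} b m≤k+b = begin
  + m - + b            ≡⟨ ℤ.m-n≡m⊖n m b ⟩
  m ℤ.⊖ b              ≤⟨ ℤ.⊖-monoˡ-≤ b m≤k+b ⟩
  (k + b) ℤ.⊖ b        ≡⟨ ℤ.⊖-≥ (m≤n+m b k) ⟩
  + (k + b ∸ b)        ≡⟨ cong +_ (m+n∸n≡m k b) ⟩
  + k                  ∎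
  where open ℤ.≤-Reasoning

theorem4p7 : ∀ {n : ℕ} (G : Graph n) (W : Subset n) →
    Connected G → PairwiseTrueTwins G W → 2 ≤ ∣ W ∣ →
    ∀ (d d′ : ℕ) →
    IsDiameter (𝓡 G) d →
    IsDiameter (𝓡 (G −ᴱ E[ G , W ])) d′ →
    (+ d) - (+ (∣ W ∣ C 2)) ≤ℤ + d′
theorem4p7 G W _ twins _ d d′ diam diam′ = ⊖-bound (∣ W ∣ C 2) (diameter-bound G W twins diam diam′)
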